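{- For every $\delta>0$ there exist $\epsilon>0$ and $C>0$ such that the following holds for every finite abelian group $G$ of order $n\ge 2$. There exists a collection $\mathcal{F}_\delta$ of subsets of $G$, each of size at least $\epsilon n$, with $|\mathcal{F}_\delta|\le \exp(C(\log n)^2)$, such that for every $A\subseteq G$ with $|A|\ge \delta n$, the sumset $A+A$ contains some $F\in\mathcal{F}_\delta$ as a subset.
   Context: $A+A=\{a+b:a,b\in A\}$. -}

module Defs where

open import Level using (0ℓ)
open import Data.Nat using (ℕ; _^_; _*_)
open import Data.Nat.Logarithm using (⌈log₂_⌉)
open import Data.Fin using (Fin)
open import Data.Fin.Subset using (Subset; _∈_; _⊆_; ∣_∣)
open import Data.Product using (Σ; _×_; ∃)
open import Data.Integer using (+_)
open import Data.List using (List; length)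
open import Data.List.Relation.Unary.Any using (Any)
open import Relation.Binary.PropositionalEquality using (_≡_)
open import Algebra.Structures using (IsAbelianGroup)
import Data.Rational as ℚ
open ℚ using (ℚ)

-- A finite abelian group of order n, represented (up to isomorphism) with
-- underlying set Fin n and propositional equality.
record FinAbGroup (n : ℕ) : Set where
  field
    _∙_ : Fin n → Fin n → Fin n
    ε   : Fin n
    _⁻¹ : Fin n → Fin n
    isAbelianGroup : IsAbelianGroup _≡_ _∙_ ε _⁻¹

_⊆_+ˢ_within_ : ∀ {n} → Subset n → Subset n → Subset n → FinAbGroup n → Set
_⊆_+ˢ_within_ {n} F A B G = ∀ x → x ∈ F →
  Σ (Fin n) λ a → Σ (Fin n) λ b → a ∈ A × b ∈ B × (a ∙ b) ≡ x
  where open FinAbGroup G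

ℕ→ℚ : ℕ → ℚ
ℕ→ℚ k = + k ℚ./ 1

AtLeastFraction : ∀ {n} → ℚ → Subset n → Set
AtLeastFraction {n} r S = r ℚ.* ℕ→ℚ n ℚ.≤ ℕ→ℚ ∣ S ∣

-- the size bound exp(C (log n)^2), rendered as 2^(C * ⌈log₂ n⌉^2)
sizeBound : ℕ → ℕ → ℕ
sizeBound C n = 2 ^ (C * (⌈log₂ n ⌉ ^ 2))

{-# OPTIONS --safe #-}
module Submission where

-- It suffices to treat difference sets: by averaging there is c with B = A ∩ cA⁻¹ of density
-- at least δ², and c·BB⁻¹ ⊆ A + A, so c costs only a factor n.
--
-- Work in ℤ[G] with the cone of sums of the elements s s°, where s°(x) = s(x⁻¹); on it the
-- coefficient at the identity, written Φ below for m-th powers, is nonnegative (it plays the role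
-- of a normalised trace).  Put U_t = [t] + [t⁻¹] and start from Y = 4k.  Averaged over t,
-- the coefficient of (Y - U_t)^m at the identity exceeds that of Y^m only by a factor
-- 1 + 1/κ² (κ = k/m), because the first-order terms sum to -2m times the augmentation of Y^(m-1),
-- which is nonnegative.  Hence, by Markov, the set F_Y of those t for which the factor is at most
-- 1 + 2/κ² has positive density.  If F_Y ⊆ BB⁻¹, stop.  Otherwise pick t ∈ F_Y outside BB⁻¹ and
-- replace Y by Y - U_t.  Such t correlate negatively with the centred indicator of B, so after
-- k steps Y has an "eigenvalue" at least 4k(1 + δ²/2); then Y^m has coefficient at least
-- (4k(1 + δ²/2))^m / n, contradicting the slow growth once m ≫ log n.  Thus every F that can
-- occur is determined by c and at most k = O(log n) elements of G.

open import Defs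
open import Algebra.Bundles using (CommutativeRing; AbelianGroup)
import Algebra.Properties.AbelianGroup as AbelianGroupProperties
import Algebra.Properties.Semiring.Sum as SemiringSum
open import Data.Bool using (Bool; true; false; if_then_else_)
open import Data.Empty using (⊥)
open import Data.Fin using (Fin; zero; suc; _≟_)
open import Data.Fin.Permutation using (permutation)
open import Data.Fin.Properties using (all?; any?; ¬∀⟶∃¬)
open import Data.Fin.Subset using (Subset; ∣_∣; _∈_)
open import Data.Fin.Subset.Properties using (_∈?_)
open import Data.Integer as ℤ using (ℤ; +_; 0ℤ; 1ℤ)
import Data.Integer.Properties as ℤₚ
open import Data.Integer.Tactic.RingSolver using (solve-∀)
open import Data.List as List using (List; length; concat)
open import Data.List.Properties using (length-++)
open import Data.List.Relation.Unary.All as All using (All)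
import Data.List.Relation.Unary.All.Properties as All
open import Data.List.Relation.Unary.Any as Any using (Any)
import Data.List.Relation.Unary.Any.Properties as Any
open import Data.Nat as ℕ using (ℕ; zero; suc; _≤_; z≤n; s≤s)
open import Data.Nat.Logarithm using (⌈log₂_⌉; ⌈log₂⌉-mono-≤; ⌈log₂⌈n/2⌉⌉≡⌈log₂n⌉∸1)
import Data.Nat.Properties as ℕₚ
open import Data.Nat.Tactic.RingSolver using () renaming (solve-∀ to ℕ-solve-∀)
open import Data.Product using (Σ; ∃; _×_; _,_)
open import Data.Rational as ℚ using (ℚ; Positive)
import Data.Rational.Properties as ℚₚ
import Data.Rational.Unnormalised as ℚᵘ
import Data.Rational.Unnormalised.Properties as ℚᵘₚ
open import Data.Vec using (lookup; tabulate; []; _∷_)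
open import Data.Vec.Properties using (lookup∘tabulate; []=⇒lookup; lookup⇒[]=)
open import Function using (_∘_)
open import Level using (0ℓ)
open import Relation.Binary.PropositionalEquality using (_≡_; refl; sym; trans; cong; cong₂; subst; subst₂; module ≡-Reasoning)
open import Relation.Nullary using (¬_; Dec; does; yes; no; contradiction)
open import Relation.Nullary.Decidable using (dec-true; _×-dec_)

open SemiringSum (CommutativeRing.semiring ℤₚ.+-*-commutativeRing)
  using (sum; sum-cong-≗; sum-permute; ∑-comm; *-distribˡ-sum; *-distribʳ-sum; ∑-distrib-+; sum-replicate-zero)

private variable n : ℕ

-- Numerical estimates

module Arithmetic where
  open import Data.Nat
  open import Data.Nat.Induction using (<-rec)
  open import Data.Nat.Properties
  open ≤-Reasoning

  ^-distribʳ-* : ∀ a b e → (a * b) ^ e ≡ a ^ e * b ^ e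
  ^-distribʳ-* a b zero    = refl
  ^-distribʳ-* a b (suc e) = trans (cong (a * b *_) (^-distribʳ-* a b e)) (lem a b (a ^ e) (b ^ e))
    where
    lem : ∀ a b x y → a * b * (x * y) ≡ a * x * (b * y)
    lem = ℕ-solve-∀

  -- This is `(1 + 2/κ²)^i ≤ 1 + 4i/κ²` with denominators cleared. The cross term `8i` of the
  -- induction step is at most `2κ²` because `4 ≤ κ` and `i ≤ κ`.
  [κ²+2]^i-bound : ∀ κ i → 4 ≤ κ → i ≤ κ → (κ * κ + 2) ^ i * (κ * κ) ≤ (κ * κ) ^ i * (κ * κ + 4 * i)
  [κ²+2]^i-bound κ zero 4≤κ i≤κ = ≤-reflexive (lem (κ * κ))
    where
    lem : ∀ a → 1 * a ≡ 1 * (a + 4 * 0)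
    lem = ℕ-solve-∀
  [κ²+2]^i-bound κ (suc i) 4≤κ i<κ = begin
    (A + 2) * (A + 2) ^ i * A          ≡⟨ *-assoc (A + 2) ((A + 2) ^ i) A ⟩
    (A + 2) * ((A + 2) ^ i * A)        ≤⟨ *-monoʳ-≤ (A + 2) ([κ²+2]^i-bound κ i 4≤κ (<⇒≤ i<κ)) ⟩
    (A + 2) * (A ^ i * (A + 4 * i))    ≡⟨ lem₁ A (A ^ i) i ⟩
    A ^ i * (A * (A + 4 * i + 2) + 2 * (4 * i))
      ≤⟨ *-monoʳ-≤ (A ^ i) (+-monoʳ-≤ (A * (A + 4 * i + 2)) (*-monoʳ-≤ 2 (*-mono-≤ 4≤κ (<⇒≤ i<κ)))) ⟩
    A ^ i * (A * (A + 4 * i + 2) + 2 * A) ≡⟨ lem₂ A (A ^ i) i ⟩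
    A * A ^ i * (A + 4 * suc i)        ∎
    where
    A = κ * κ
    lem₁ : ∀ A P i → (A + 2) * (P * (A + 4 * i)) ≡ P * (A * (A + 4 * i + 2) + 2 * (4 * i))
    lem₁ = ℕ-solve-∀
    lem₂ : ∀ A P i → P * (A * (A + 4 * i + 2) + 2 * A) ≡ A * P * (A + 4 * suc i)
    lem₂ = ℕ-solve-∀

  -- Bernoulli's inequality for `(1 + 1/e)^i`, cleared of denominators.
  bernoulli-ℕ : ∀ e i → e ^ i * (e + i) ≤ suc e ^ i * e
  bernoulli-ℕ e zero = ≤-reflexive (cong (1 *_) (+-identityʳ e))
  bernoulli-ℕ e (suc i) = begin
    e * e ^ i * (e + suc i)            ≤⟨ m≤m+n _ (e ^ i * i) ⟩
    e * e ^ i * (e + suc i) + e ^ i * i ≡⟨ lem e (e ^ i) i ⟩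
    suc e * (e ^ i * (e + i))          ≤⟨ *-monoʳ-≤ (suc e) (bernoulli-ℕ e i) ⟩
    suc e * (suc e ^ i * e)            ≡⟨ *-assoc (suc e) (suc e ^ i) e ⟨
    suc e * suc e ^ i * e              ∎
    where
    lem : ∀ e P i → e * P * (e + suc i) + P * i ≡ suc e * (P * (e + i))
    lem = ℕ-solve-∀

  2*e^e≤[1+e]^e : ∀ e .{{_ : NonZero e}} → 2 * e ^ e ≤ suc e ^ e
  2*e^e≤[1+e]^e e = *-cancelʳ-≤ (2 * e ^ e) (suc e ^ e) e (subst (_≤ suc e ^ e * e) (lem e (e ^ e)) (bernoulli-ℕ e e))
    where
    lem : ∀ e P → P * (e + e) ≡ 2 * P * e
    lem = ℕ-solve-∀

  module _ (d L : ℕ) .{{_ : NonZero d}} where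

    -- `m` will be the exponent in the potential and `K` the depth of the tree of choices; for fixed
    -- `d` both are linear in `L`.
    e κ m K : ℕ
    e = suc (4 * d)
    κ = 16 * d
    m = e * suc L
    K = κ * m

    -- At `i = κ` the bound above reads `(1 + 2/κ²)^κ ≤ 1 + 4/κ`, and `κ = 16d` makes the right side
    -- `e/4d`.
    κ-power : (κ * κ + 2) ^ κ * (4 * d) ≤ (κ * κ) ^ κ * e
    κ-power = *-cancelʳ-≤ _ _ (4 * κ) {{m*n≢0 4 κ {{_}} {{m*n≢0 16 d}}}} (subst₂ _≤_ (lem₁ ((κ * κ + 2) ^ κ) d) (lem₂ ((κ * κ) ^ κ) d)
      ([κ²+2]^i-bound κ κ (≤-trans (m≤m*n 4 4) (m≤m*n 16 d)) ≤-refl))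
      where
      lem₁ : ∀ P d → P * ((16 * d) * (16 * d)) ≡ P * (4 * d) * (4 * (16 * d))
      lem₁ = ℕ-solve-∀
      lem₂ : ∀ P d → P * ((16 * d) * (16 * d) + 4 * (16 * d)) ≡ P * suc (4 * d) * (4 * (16 * d))
      lem₂ = ℕ-solve-∀

    -- The parameters make (1 + 1/2d) / (1 + 2/κ²)^κ at least 1 + 1/e, and (1 + 1/e)^m ≥ 2^(L+1) > n.
    growth-contradiction : ∀ n → n ≤ 2 ^ L →
      (4 * K + 2 * (16 * m)) ^ m * (κ * κ) ^ K ≤ n * ((κ * κ + 2) ^ K * (4 * K) ^ m) → ⊥
    growth-contradiction n n≤ h = <-irrefl refl (begin-strict
      n * e ^ m                    <⟨ *-monoˡ-< (e ^ m) {{m^n≢0 e m}} (≤-<-trans n≤ (^-monoʳ-< 2 (s≤s (s≤s z≤n)) (n<1+n L))) ⟩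
      2 ^ suc L * e ^ m            ≡⟨ cong (2 ^ suc L *_) (^-*-assoc e e (suc L)) ⟨
      2 ^ suc L * (e ^ e) ^ suc L  ≡⟨ ^-distribʳ-* 2 (e ^ e) (suc L) ⟨
      (2 * e ^ e) ^ suc L          ≤⟨ ^-monoˡ-≤ (suc L) (2*e^e≤[1+e]^e e) ⟩
      (suc e ^ e) ^ suc L          ≡⟨ ^-*-assoc (suc e) e (suc L) ⟩
      suc e ^ m                    ≤⟨ main ⟩
      n * e ^ m                    ∎)
      where
      M = 4 * K
      A^κ = (κ * κ) ^ κ
      B^κ = (κ * κ + 2) ^ κ
      instance
        A≢0 : NonZero ((κ * κ) ^ K)
        A≢0 = m^n≢0 (κ * κ) K {{m*n≢0 κ κ {{m*n≢0 16 d}} {{m*n≢0 16 d}}}}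
        M≢0 : NonZero (M ^ m)
        M≢0 = m^n≢0 M m {{m*n≢0 4 K {{_}} {{m*n≢0 κ m {{m*n≢0 16 d}} {{m*n≢0 e (suc L)}}}}}}
      B≤A : (κ * κ + 2) ^ K * (4 * d) ^ m ≤ (κ * κ) ^ K * e ^ m
      B≤A = begin
        (κ * κ + 2) ^ K * (4 * d) ^ m  ≡⟨ cong (_* (4 * d) ^ m) (^-*-assoc (κ * κ + 2) κ m) ⟨
        B^κ ^ m * (4 * d) ^ m          ≡⟨ ^-distribʳ-* B^κ (4 * d) m ⟨
        (B^κ * (4 * d)) ^ m            ≤⟨ ^-monoˡ-≤ m κ-power ⟩
        (A^κ * e) ^ m                  ≡⟨ ^-distribʳ-* A^κ e m ⟩
        A^κ ^ m * e ^ m                ≡⟨ cong (_* e ^ m) (^-*-assoc (κ * κ) κ m) ⟩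
        (κ * κ) ^ K * e ^ m            ∎
      -- The gain `(4K + 32m)/4K = 1 + 1/2d` is `(e + 1)/4d`, with the same denominator as the loss
      -- `e/4d` from `κ-power`.
      base : ∀ d m → 4 * (16 * d * m) * suc (suc (4 * d)) ≡ (4 * (16 * d * m) + 2 * (16 * m)) * (4 * d)
      base = ℕ-solve-∀
      main : suc e ^ m ≤ n * e ^ m
      main = *-cancelˡ-≤ ((κ * κ) ^ K * M ^ m) {{m*n≢0 ((κ * κ) ^ K) (M ^ m)}} (begin
        (κ * κ) ^ K * M ^ m * suc e ^ m
          ≡⟨ *-assoc ((κ * κ) ^ K) (M ^ m) (suc e ^ m) ⟩
        (κ * κ) ^ K * (M ^ m * suc e ^ m)
          ≡⟨ cong ((κ * κ) ^ K *_) (trans (sym (^-distribʳ-* M (suc e) m)) (trans (cong (_^ m) (base d m)) (^-distribʳ-* (M + 2 * (16 * m)) (4 * d) m))) ⟩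
        (κ * κ) ^ K * ((M + 2 * (16 * m)) ^ m * (4 * d) ^ m)
          ≡⟨ lem₁ ((κ * κ) ^ K) ((M + 2 * (16 * m)) ^ m) ((4 * d) ^ m) ⟩
        ((M + 2 * (16 * m)) ^ m * (κ * κ) ^ K) * (4 * d) ^ m
          ≤⟨ *-monoˡ-≤ ((4 * d) ^ m) h ⟩
        n * ((κ * κ + 2) ^ K * M ^ m) * (4 * d) ^ m
          ≡⟨ lem₂ n ((κ * κ + 2) ^ K) (M ^ m) ((4 * d) ^ m) ⟩
        n * M ^ m * ((κ * κ + 2) ^ K * (4 * d) ^ m)
          ≤⟨ *-monoʳ-≤ (n * M ^ m) B≤A ⟩
        n * M ^ m * ((κ * κ) ^ K * e ^ m)
          ≡⟨ lem₃ n (M ^ m) ((κ * κ) ^ K) (e ^ m) ⟩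
        (κ * κ) ^ K * M ^ m * (n * e ^ m) ∎)
        where
        lem₁ : ∀ a b c → a * (b * c) ≡ (b * a) * c
        lem₁ = ℕ-solve-∀
        lem₂ : ∀ n b c d → n * (b * c) * d ≡ n * c * (b * d)
        lem₂ = ℕ-solve-∀
        lem₃ : ∀ n c a e → n * c * (a * e) ≡ a * c * (n * e)
        lem₃ = ℕ-solve-∀

    -- The factor `n` counts the choices of `c`, and `(n + 1)^K` bounds a tree of depth `K`. Since
    -- `n + 1 ≤ 2^(2L)` and `K ≤ 32deL`, the exponent is quadratic in `L`.
    family-bound : ∀ n → n ≤ 2 ^ L → 1 ≤ L → n * suc n ^ K ≤ 2 ^ (suc (64 * d * e) * L ^ 2)
    family-bound n n≤ 1≤L = begin
      n * suc n ^ K                       ≤⟨ *-mono-≤ n≤ (^-monoˡ-≤ K suc-n≤) ⟩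
      2 ^ L * (2 ^ (L + L)) ^ K           ≡⟨ cong (2 ^ L *_) (^-*-assoc 2 (L + L) K) ⟩
      2 ^ L * 2 ^ ((L + L) * K)           ≡⟨ ^-distribˡ-+-* 2 L ((L + L) * K) ⟨
      2 ^ (L + (L + L) * K)               ≤⟨ ^-monoʳ-≤ 2 exponent ⟩
      2 ^ (suc (64 * d * e) * L ^ 2)      ∎
      where
      suc-n≤ : suc n ≤ 2 ^ (L + L)
      suc-n≤ = begin
        1 + n           ≤⟨ +-mono-≤ (^-monoʳ-≤ 2 {0} {L} z≤n) n≤ ⟩
        2 ^ L + 2 ^ L   ≡⟨ cong (_+_ (2 ^ L)) (+-identityʳ (2 ^ L)) ⟨
        2 ^ suc L       ≤⟨ ^-monoʳ-≤ 2 (+-monoˡ-≤ L 1≤L) ⟩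
        2 ^ (L + L)     ∎
      exponent : L + (L + L) * K ≤ suc (64 * d * e) * L ^ 2
      exponent = begin
        L + (L + L) * (16 * d * (e * (1 + L)))  ≤⟨ +-mono-≤ (subst (_≤ L * L) (*-identityʳ L) (*-monoʳ-≤ L 1≤L))
                                                     (*-monoʳ-≤ (L + L) (*-monoʳ-≤ (16 * d) (*-monoʳ-≤ e (+-monoˡ-≤ L 1≤L)))) ⟩
        L * L + (L + L) * (16 * d * (e * (L + L))) ≡⟨ lem d e L ⟩
        suc (64 * d * e) * L ^ 2 ∎
        where
        lem : ∀ d e L → L * L + (L + L) * (16 * d * (e * (L + L))) ≡ suc (64 * d * e) * (L * (L * 1))
        lem = ℕ-solve-∀

  1≤⌈log₂n⌉ : ∀ {n} → 2 ≤ n → 1 ≤ ⌈log₂ n ⌉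
  1≤⌈log₂n⌉ = ⌈log₂⌉-mono-≤

  n≤2^⌈log₂n⌉ : ∀ n → n ≤ 2 ^ ⌈log₂ n ⌉
  n≤2^⌈log₂n⌉ = <-rec (λ n → n ≤ 2 ^ ⌈log₂ n ⌉) step
    where
    step : ∀ n → (∀ {i} → i < n → i ≤ 2 ^ ⌈log₂ i ⌉) → n ≤ 2 ^ ⌈log₂ n ⌉
    step 0 rec = z≤n
    step 1 rec = s≤s z≤n
    step n@(suc (suc n-2)) rec = begin
      n                            ≡⟨ ⌊n/2⌋+⌈n/2⌉≡n n ⟨
      ⌊ n /2⌋ + ⌈ n /2⌉            ≤⟨ +-monoˡ-≤ ⌈ n /2⌉ (⌊n/2⌋≤⌈n/2⌉ n) ⟩
      ⌈ n /2⌉ + ⌈ n /2⌉            ≡⟨ cong (_+_ ⌈ n /2⌉) (+-identityʳ ⌈ n /2⌉) ⟨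
      2 * ⌈ n /2⌉                  ≤⟨ *-monoʳ-≤ 2 (rec (⌈n/2⌉<n n-2)) ⟩
      2 * 2 ^ ⌈log₂ ⌈ n /2⌉ ⌉      ≡⟨ cong (λ l → 2 * 2 ^ l) (⌈log₂⌈n/2⌉⌉≡⌈log₂n⌉∸1 n) ⟩
      2 ^ (1 + (⌈log₂ n ⌉ ∸ 1))    ≡⟨ cong (2 ^_) (m+[n∸m]≡n (1≤⌈log₂n⌉ {n} (s≤s (s≤s z≤n)))) ⟩
      2 ^ ⌈log₂ n ⌉                ∎

-- Positive cones in commutative rings

record IsCone (R : CommutativeRing 0ℓ 0ℓ) (K : CommutativeRing.Carrier R → Set) : Set where
  open CommutativeRing R using (_≈_; _+_; _*_; 0#; 1#)
  field
    K-resp : ∀ {x y} → x ≈ y → K x → K y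
    K-+    : ∀ {x y} → K x → K y → K (x + y)
    K-*    : ∀ {x y} → K x → K y → K (x * y)
    K-0    : K 0#
    K-1    : K 1#

module Cone (R : CommutativeRing 0ℓ 0ℓ) (K : CommutativeRing.Carrier R → Set) (isCone : IsCone R K) where
  open IsCone isCone
  open CommutativeRing R using (Carrier; _≈_; _+_; _*_; 0#; 1#; setoid; semiring; ring; commutativeSemiring;
    +-cong; +-congˡ; +-congʳ; *-cong; *-congˡ; *-congʳ; +-identityʳ) renaming (refl to ≈-refl)
  open import Algebra.Properties.Semiring.Mult semiring public
    using (×-homo-+; ×1-homo-*) renaming (_×_ to _·_)
  open import Algebra.Properties.Semiring.Exp semiring public using (_^_)
  open import Algebra.Properties.Ring ring using (+-cancelʳ)
  open import Algebra.Solver.Ring.NaturalCoefficients.Default commutativeSemiring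
    using (solve; _:=_; con; _:+_; _:*_)
  open import Relation.Binary.Reasoning.Setoid setoid

  ι : ℕ → Carrier
  ι n = n · 1#

  -- The inequalities below have their negative terms moved to the other side,
  -- which makes them accessible to the semiring solver.
  infix 4 _≼_
  _≼_ : Carrier → Carrier → Set
  x ≼ y = ∃ λ s → K s × x + s ≈ y

  K-ι : ∀ n → K (ι n)
  K-ι zero    = K-0
  K-ι (suc n) = K-+ K-1 (K-ι n)

  K-^ : ∀ {x} n → K x → K (x ^ n)
  K-^ zero    k = K-1
  K-^ (suc n) k = K-* k (K-^ n k)

  1≼^ : ∀ {x} n → 1# ≼ x → 1# ≼ x ^ n
  1≼^ zero _ = 0# , K-0 , +-identityʳ 1#
  1≼^ {x} (suc n) (s , ks , es) with 1≼^ n (s , ks , es)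
  ... | s′ , ks′ , es′ = s + s′ + s * s′ , K-+ (K-+ ks ks′) (K-* ks ks′) , (begin
    1# + (s + s′ + s * s′) ≈⟨ solve 2 (λ s t → con 1 :+ (s :+ t :+ s :* t) := (con 1 :+ s) :* (con 1 :+ t)) ≈-refl s s′ ⟩
    (1# + s) * (1# + s′)   ≈⟨ *-cong es es′ ⟩
    x * x ^ n              ∎)

  -- The graph of Y ↦ Y^(j+1) lies above its tangent at c.
  bernoulli : ∀ {Y c} → K Y → K c → Y * c + Y * c ≼ Y * Y + c * c →
    ∀ j → ι (suc j) * (c ^ j * Y) ≼ Y ^ suc j + ι j * c ^ suc j
  bernoulli {Y} {c} kY kc _ zero = 0# , K-0 ,
    solve 2 (λ Y c → (con 1 :+ con 0) :* (con 1 :* Y) :+ con 0 := Y :* con 1 :+ con 0 :* (c :* con 1)) ≈-refl Y c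
  bernoulli {Y} {c} kY kc (q , kq , eq) (suc j) with bernoulli kY kc (q , kq , eq) j
  ... | s , ks , es = s * Y + ι (suc j) * (C * q) ,
      -- Multiply the inductive identity by `Y`. As `q = (Y - c)²`, replacing `Y²` by `2Yc - c² + q`
      -- leaves the extra slack `(j + 1) c^j q`.
      K-+ (K-* ks kY) (K-* (K-ι (suc j)) (K-* (K-^ j kc) kq)) ,
      +-cancelʳ (a * (c * C) * Y) _ _ (begin
        (1# + (1# + a)) * ((c * C) * Y) + (s * Y + (1# + a) * (C * q)) + a * (c * C) * Y
          ≈⟨ solve 6 (λ a C c Y s q →
               (con 1 :+ (con 1 :+ a)) :* ((c :* C) :* Y) :+ (s :* Y :+ (con 1 :+ a) :* (C :* q)) :+ a :* (c :* C) :* Y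
               := (con 1 :+ a) :* C :* (Y :* c :+ Y :* c :+ q) :+ s :* Y) ≈-refl a C c Y s q ⟩
        (1# + a) * C * (Y * c + Y * c + q) + s * Y
          ≈⟨ +-congʳ (*-congˡ eq) ⟩
        (1# + a) * C * (Y * Y + c * c) + s * Y
          ≈⟨ solve 5 (λ a C c Y s → (con 1 :+ a) :* C :* (Y :* Y :+ c :* c) :+ s :* Y
               := ((con 1 :+ a) :* (C :* Y) :+ s) :* Y :+ (con 1 :+ a) :* (c :* (c :* C))) ≈-refl a C c Y s ⟩
        ((1# + a) * (C * Y) + s) * Y + (1# + a) * (c * (c * C))
          ≈⟨ +-congʳ (*-congʳ es) ⟩
        (Y * P + a * (c * C)) * Y + (1# + a) * (c * (c * C))
          ≈⟨ solve 5 (λ a C c Y P → (Y :* P :+ a :* (c :* C)) :* Y :+ (con 1 :+ a) :* (c :* (c :* C))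
               := Y :* (Y :* P) :+ (con 1 :+ a) :* (c :* (c :* C)) :+ a :* (c :* C) :* Y) ≈-refl a C c Y P ⟩
        Y * (Y * P) + (1# + a) * (c * (c * C)) + a * (c * C) * Y ∎)
    where
    a = ι j
    C = c ^ j
    P = Y ^ j

  -- (Y - U)^m ≼ Y^m - m Y^(m-1) U + m² Y^(m-2) U², where m = j + 2.  The induction multiplies by Y - U;
  -- the cubic term - m² Y^(m-2) U³ that arises is absorbed by m Y^(m-1) U² since Y + m U is positive.
  second-order : ∀ {Y V U} → K Y → K V → K (U * U) → V + U ≈ Y →
    ∀ {N} → (∀ i → i ≤ N → K (Y + ι i * U)) →
    ∀ j → suc j ≤ N →
    V ^ (2 ℕ.+ j) + ι (2 ℕ.+ j) * (Y ^ suc j * U)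
      ≼ Y ^ (2 ℕ.+ j) + ι (2 ℕ.+ j) * ι (2 ℕ.+ j) * (Y ^ j * (U * U))
  second-order {Y} {V} {U} kY kV kU eq hyp zero _ =
    -- Exactly, `V² = Y² - 2YU + U²`, while the bound allows `4U²`.
    ι 3 * (U * U) , K-* (K-ι 3) kU , (begin
      V * (V * 1#) + ι 2 * ((Y * 1#) * U) + ι 3 * (U * U)
        ≈⟨ +-congʳ (+-congˡ (*-congˡ (*-congʳ (*-congʳ eq)))) ⟨
      V * (V * 1#) + ι 2 * (((V + U) * 1#) * U) + ι 3 * (U * U)
        ≈⟨ solve 2 (λ V U → V :* (V :* con 1) :+ (con 1 :+ (con 1 :+ con 0)) :* (((V :+ U) :* con 1) :* U) :+ (con 1 :+ (con 1 :+ (con 1 :+ con 0))) :* (U :* U)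
             := (V :+ U) :* ((V :+ U) :* con 1) :+ (con 1 :+ (con 1 :+ con 0)) :* (con 1 :+ (con 1 :+ con 0)) :* (con 1 :* (U :* U))) ≈-refl V U ⟩
      (V + U) * ((V + U) * 1#) + ι 2 * ι 2 * (1# * (U * U))
        ≈⟨ +-congʳ (*-cong eq (*-congʳ eq)) ⟩
      Y * (Y * 1#) + ι 2 * ι 2 * (1# * (U * U)) ∎)
  second-order {Y} {V} {U} kY kV kU eq hyp (suc j) le
    with second-order kY kV kU eq hyp j (ℕₚ.≤-trans (ℕₚ.n≤1+n _) le)
  ... | s , ks , es =
    -- With `a = m`, the slack beyond `V s` is `(a + 1) Y^(m-1) U² + a² Y^(m-2) U³`, grouped so that
    -- each summand lies in the cone.
    V * s + a * ((U * U) * (P * W)) + (U * U) * (P * Y) ,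
    K-+ (K-+ (K-* kV ks) (K-* (K-ι (2 ℕ.+ j)) (K-* kU (K-* (K-^ j kY) (hyp (2 ℕ.+ j) le))))) (K-* kU (K-* (K-^ j kY) kY)) ,
    +-cancelʳ (V * (a * ((Y * P) * U))) _ _ (begin
      V * Q + (1# + a) * ((Y * (Y * P)) * U) + (V * s + a * ((U * U) * (P * (Y + a * U))) + (U * U) * (P * Y)) + V * (a * ((Y * P) * U))
        ≈⟨ solve 7 (λ a P V U Y Q s →
             V :* Q :+ (con 1 :+ a) :* ((Y :* (Y :* P)) :* U) :+ (V :* s :+ a :* ((U :* U) :* (P :* (Y :+ a :* U))) :+ (U :* U) :* (P :* Y)) :+ V :* (a :* ((Y :* P) :* U))
             := V :* (Q :+ a :* ((Y :* P) :* U) :+ s) :+ ((con 1 :+ a) :* ((Y :* (Y :* P)) :* U) :+ (a :* ((U :* U) :* (P :* (Y :+ a :* U))) :+ (U :* U) :* (P :* Y)))) ≈-refl a P V U Y Q s ⟩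
      V * (Q + a * ((Y * P) * U) + s) + rest Y
        ≈⟨ +-congʳ (*-congˡ es) ⟩
      V * (Y * (Y * P) + a * a * (P * (U * U))) + rest Y
        ≈⟨ swapY ⟨
      V * ((V + U) * ((V + U) * P) + a * a * (P * (U * U))) + rest (V + U)
        ≈⟨ solve 4 (λ a P V U →
             V :* ((V :+ U) :* ((V :+ U) :* P) :+ a :* a :* (P :* (U :* U))) :+ ((con 1 :+ a) :* (((V :+ U) :* ((V :+ U) :* P)) :* U) :+ (a :* ((U :* U) :* (P :* ((V :+ U) :+ a :* U))) :+ (U :* U) :* (P :* (V :+ U))))
             := (V :+ U) :* ((V :+ U) :* ((V :+ U) :* P)) :+ (con 1 :+ a) :* (con 1 :+ a) :* (((V :+ U) :* P) :* (U :* U)) :+ V :* (a :* (((V :+ U) :* P) :* U))) ≈-refl a P V U ⟩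
      (V + U) * ((V + U) * ((V + U) * P)) + (1# + a) * (1# + a) * (((V + U) * P) * (U * U)) + V * (a * (((V + U) * P) * U))
        ≈⟨ +-cong (+-cong (*-cong eq (*-cong eq (*-congʳ eq))) (*-congˡ (*-congʳ (*-congʳ eq)))) (*-congˡ (*-congˡ (*-congʳ (*-congʳ eq)))) ⟩
      Y * (Y * (Y * P)) + (1# + a) * (1# + a) * ((Y * P) * (U * U)) + V * (a * ((Y * P) * U)) ∎)
    where
    a = ι (2 ℕ.+ j)
    P = Y ^ j
    Q = V ^ (2 ℕ.+ j)
    W = Y + a * U
    rest : Carrier → Carrier
    rest Z = (1# + a) * ((Z * (Z * P)) * U) + (a * ((U * U) * (P * (Z + a * U))) + (U * U) * (P * Z))
    -- The semiring solver has no subtraction, so the identity is verified with `V + U` in place of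
    -- `Y`, the power `P` being kept as an atom.
    swapY : V * ((V + U) * ((V + U) * P) + a * a * (P * (U * U))) + rest (V + U)
          ≈ V * (Y * (Y * P) + a * a * (P * (U * U))) + rest Y
    swapY = +-cong (*-congˡ (+-congʳ (*-cong eq (*-congʳ eq))))
      (+-cong (*-congˡ (*-congʳ (*-cong eq (*-congʳ eq))))
        (+-cong (*-congˡ (*-congˡ (*-congˡ (+-congʳ eq)))) (*-congˡ (*-congˡ eq))))

  -- From `U² ≼ 4` and `2κm ≼ Y` follows `κ² m² Y^(m-2) U² ≼ Y^m`: the second-order term costs at
  -- most a fraction `1/κ²` of `Y^m`.
  growth : ∀ {Y V U z q κ} j → let a = ι (2 ℕ.+ j) in
    K Y → K z → K q → K κ → K V → K (U * U) →
    V + U ≈ Y → (κ * a + κ * a) + z ≈ Y → U * U + q ≈ ι 4 →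
    (∀ i → i ≤ suc j → K (Y + ι i * U)) →
    κ * κ * V ^ (2 ℕ.+ j) + κ * κ * (a * (Y ^ suc j * U)) ≼ (κ * κ + 1#) * Y ^ (2 ℕ.+ j)
  growth {Y} {V} {U} {z} {q} {κ} j kY kz kq kκ kV kU eV eY e4 hyp
    with second-order kY kV kU eV hyp j ℕₚ.≤-refl
  ... | s , ks , es =
    -- `k² q` is the slack in `k² U² ≼ 4k²`, and `4kz + z²` is that in `4k² ≼ (2k + z)² = Y²`.
    κ * κ * s + P * (k * k * q + (k + k) * (z + z) + z * z) ,
    K-+ (K-* (K-* kκ kκ) ks) (K-* (K-^ j kY) (K-+ (K-+ (K-* (K-* kk kk) kq) (K-* (K-+ kk kk) (K-+ kz kz))) (K-* kz kz))) ,
    (begin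
      κ * κ * V ^ (2 ℕ.+ j) + κ * κ * (a * (Y ^ suc j * U)) + (κ * κ * s + P * (k * k * q + (k + k) * (z + z) + z * z))
        ≈⟨ solve 6 (λ κ v w s P r → κ :* κ :* v :+ κ :* κ :* w :+ (κ :* κ :* s :+ P :* r)
                                   := κ :* κ :* (v :+ w :+ s) :+ P :* r) ≈-refl κ _ _ s P _ ⟩
      κ * κ * (V ^ (2 ℕ.+ j) + a * (Y ^ suc j * U) + s) + P * (k * k * q + (k + k) * (z + z) + z * z)
        ≈⟨ +-congʳ (*-congˡ es) ⟩
      κ * κ * (Y ^ (2 ℕ.+ j) + a * a * (P * (U * U))) + P * (k * k * q + (k + k) * (z + z) + z * z)
        ≈⟨ solve 7 (λ κ a y P u q z → let k = κ :* a in
             κ :* κ :* (y :+ a :* a :* (P :* u)) :+ P :* (k :* k :* q :+ (k :+ k) :* (z :+ z) :+ z :* z)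
             := κ :* κ :* y :+ P :* (k :* k :* (u :+ q) :+ (k :+ k) :* (z :+ z) :+ z :* z)) ≈-refl κ a (Y ^ (2 ℕ.+ j)) P (U * U) q z ⟩
      κ * κ * Y ^ (2 ℕ.+ j) + P * (k * k * (U * U + q) + (k + k) * (z + z) + z * z)
        ≈⟨ +-congˡ (*-congˡ (+-congʳ (+-congʳ (*-congˡ e4)))) ⟩
      κ * κ * Y ^ (2 ℕ.+ j) + P * (k * k * ι 4 + (k + k) * (z + z) + z * z)
        ≈⟨ +-congˡ (solve 3 (λ P k z → P :* (k :* k :* (con 1 :+ (con 1 :+ (con 1 :+ (con 1 :+ con 0)))) :+ (k :+ k) :* (z :+ z) :+ z :* z)
             := (k :+ k :+ z) :* ((k :+ k :+ z) :* P)) ≈-refl P k z) ⟩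
      κ * κ * Y ^ (2 ℕ.+ j) + (k + k + z) * ((k + k + z) * P)
        ≈⟨ +-congˡ (*-cong eY (*-congʳ eY)) ⟩
      κ * κ * Y ^ (2 ℕ.+ j) + Y ^ (2 ℕ.+ j)
        ≈⟨ solve 2 (λ κ y → κ :* κ :* y :+ y := (κ :* κ :+ con 1) :* y) ≈-refl κ _ ⟩
      (κ * κ + 1#) * Y ^ (2 ℕ.+ j) ∎)
    where
    a = ι (2 ℕ.+ j)
    P = Y ^ j
    k = κ * a
    kk = K-* kκ (K-ι (2 ℕ.+ j))

-- Integer sums and indicators

sum-mono : (f g : Fin n → ℤ) → (∀ x → f x ℤ.≤ g x) → sum f ℤ.≤ sum g
sum-mono {zero}  f g h = ℤₚ.≤-refl
sum-mono {suc n} f g h = ℤₚ.+-mono-≤ (h zero) (sum-mono (f ∘ suc) (g ∘ suc) (h ∘ suc))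

sum-const : ∀ n (c : ℤ) → sum {n} (λ _ → c) ≡ + n ℤ.* c
sum-const zero    c = sym (ℤₚ.*-zeroˡ c)
sum-const (suc n) c = trans (cong (ℤ._+_ c) (sum-const n c)) (sym (ℤₚ.suc-* (+ n) c))

sum-nonneg : (f : Fin n → ℤ) → (∀ x → 0ℤ ℤ.≤ f x) → 0ℤ ℤ.≤ sum f
sum-nonneg {n} f h = subst (ℤ._≤ sum f) (trans (sum-const n 0ℤ) (ℤₚ.*-zeroʳ (+ n))) (sum-mono _ f h)

0≤x*x : ∀ x → 0ℤ ℤ.≤ x ℤ.* x
0≤x*x (+ a)      = subst (0ℤ ℤ.≤_) (ℤₚ.pos-* a a) (ℤ.+≤+ z≤n)
0≤x*x ℤ.-[1+ a ] = ℤ.+≤+ z≤n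

δ : Fin n → Fin n → ℤ
δ t y = if does (t ≟ y) then 1ℤ else 0ℤ

sum-δ : (t : Fin n) (g : Fin n → ℤ) → sum (λ y → δ t y ℤ.* g y) ≡ g t
sum-δ {suc n} zero g = begin
  1ℤ ℤ.* g zero ℤ.+ sum {n} (λ _ → 0ℤ)
    ≡⟨ cong₂ ℤ._+_ (ℤₚ.*-identityˡ (g zero)) (sum-replicate-zero n) ⟩
  g zero ℤ.+ 0ℤ
    ≡⟨ ℤₚ.+-identityʳ (g zero) ⟩
  g zero ∎
  where open ≡-Reasoning
sum-δ {suc n} (suc t) g = trans (ℤₚ.+-identityˡ _) (sum-δ t (g ∘ suc))

≤-from-diff : ∀ {a b c} → a ℤ.+ c ≡ b → 0ℤ ℤ.≤ c → a ℤ.≤ b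
≤-from-diff {a} {b} {c} e c≥0 = subst (a ℤ.≤_) e (subst (ℤ._≤ a ℤ.+ c) (ℤₚ.+-identityʳ a) (ℤₚ.+-monoʳ-≤ a c≥0))

0≤* : ∀ {a b} → 0ℤ ℤ.≤ a → 0ℤ ℤ.≤ b → 0ℤ ℤ.≤ a ℤ.* b
0≤* {+ a} {+ b} _ _ = subst (0ℤ ℤ.≤_) (ℤₚ.pos-* a b) (ℤ.+≤+ z≤n)

indicator : Bool → ℤ
indicator b = if b then 1ℤ else 0ℤ

card-sum : (S : Subset n) → + ∣ S ∣ ≡ sum (λ x → indicator (lookup S x))
card-sum [] = refl
card-sum (true  ∷ S) = cong (ℤ._+_ 1ℤ) (card-sum S)
card-sum (false ∷ S) = trans (card-sum S) (sym (ℤₚ.+-identityˡ _))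

δ-iff : ∀ {s y s′ y′ : Fin n} → (s ≡ y → s′ ≡ y′) → (s′ ≡ y′ → s ≡ y) → δ s y ≡ δ s′ y′
δ-iff {s = s} {y} {s′} {y′} to from with s ≟ y | s′ ≟ y′
... | yes _ | yes _ = refl
... | no  _ | no  _ = refl
... | yes e | no ¬e = contradiction (to e) ¬e
... | no ¬e | yes e = contradiction (from e) ¬e

-- The group ring and its sums of squares

module GroupRing {n : ℕ} (G : FinAbGroup n) where
  abelianGroup : AbelianGroup 0ℓ 0ℓ
  abelianGroup = record { isAbelianGroup = FinAbGroup.isAbelianGroup G }

  open AbelianGroup abelianGroup public using (_∙_; ε; _⁻¹; comm; assoc; identityˡ; identityʳ; inverseˡ; inverseʳ)
  open AbelianGroupProperties abelianGroup public
    using (⁻¹-involutive; ⁻¹-anti-homo-∙; ⁻¹-∙-comm; ε⁻¹≈ε; \\-leftDividesˡ; \\-leftDividesʳ)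

  sum-reindex : (σ τ : Fin n → Fin n) → (∀ x → σ (τ x) ≡ x) → (∀ x → τ (σ x) ≡ x) →
    (f : Fin n → ℤ) → sum f ≡ sum (f ∘ σ)
  sum-reindex σ τ στ τσ f = sum-permute f (permutation σ τ στ τσ)

  sum-inv : (f : Fin n → ℤ) → sum f ≡ sum (λ y → f (y ⁻¹))
  sum-inv = sum-reindex _⁻¹ _⁻¹ ⁻¹-involutive ⁻¹-involutive

  sum-shift : ∀ c (f : Fin n → ℤ) → sum f ≡ sum (λ y → f (c ∙ y))
  sum-shift c = sum-reindex (c ∙_) (c ⁻¹ ∙_) (\\-leftDividesˡ c) (\\-leftDividesʳ c)

  reflect-involutive : ∀ x y → (y ⁻¹ ∙ x) ⁻¹ ∙ x ≡ y
  reflect-involutive x y = begin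
    (y ⁻¹ ∙ x) ⁻¹ ∙ x      ≡⟨ cong (_∙ x) (⁻¹-∙-comm (y ⁻¹) x) ⟨
    (y ⁻¹ ⁻¹ ∙ x ⁻¹) ∙ x   ≡⟨ assoc _ _ _ ⟩
    y ⁻¹ ⁻¹ ∙ (x ⁻¹ ∙ x)   ≡⟨ cong₂ _∙_ (⁻¹-involutive y) (inverseˡ x) ⟩
    y ∙ ε                  ≡⟨ identityʳ y ⟩
    y                      ∎
    where open ≡-Reasoning

  sum-reflect : ∀ x (f : Fin n → ℤ) → sum f ≡ sum (λ y → f (y ⁻¹ ∙ x))
  sum-reflect x = sum-reindex (λ y → y ⁻¹ ∙ x) (λ y → y ⁻¹ ∙ x) (reflect-involutive x) (reflect-involutive x)

  -- No η, and a record for equality: otherwise unification unfolds convolutions to sums of integers.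
  record ℤ[G] : Set where
    no-eta-equality
    constructor fromCoefficients
    infix 9 _⟨_⟩
    field _⟨_⟩ : Fin n → ℤ
  open ℤ[G] public

  infix 4 _≈_
  record _≈_ (f g : ℤ[G]) : Set where
    constructor pointwise
    field at : ∀ x → f ⟨ x ⟩ ≡ g ⟨ x ⟩
  open _≈_ public

  infixl 6 _⊕_
  infixl 7 _⋆_
  _⊕_ : ℤ[G] → ℤ[G] → ℤ[G]
  (f ⊕ g) ⟨ x ⟩ = f ⟨ x ⟩ ℤ.+ g ⟨ x ⟩

  ⊖_ : ℤ[G] → ℤ[G]
  (⊖ f) ⟨ x ⟩ = ℤ.- f ⟨ x ⟩

  𝟘 : ℤ[G]
  𝟘 ⟨ x ⟩ = 0ℤ

  [_] : Fin n → ℤ[G]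
  [ t ] ⟨ x ⟩ = δ t x

  _⋆_ : ℤ[G] → ℤ[G] → ℤ[G]
  (f ⋆ g) ⟨ x ⟩ = sum (λ y → f ⟨ y ⟩ ℤ.* g ⟨ y ⁻¹ ∙ x ⟩)

  []-⋆ : ∀ t p x → ([ t ] ⋆ p) ⟨ x ⟩ ≡ p ⟨ t ⁻¹ ∙ x ⟩
  []-⋆ t p x = sum-δ t (λ y → p ⟨ y ⁻¹ ∙ x ⟩)

  ⋆-cong : ∀ {f f′ g g′} → f ≈ f′ → g ≈ g′ → f ⋆ g ≈ f′ ⋆ g′
  ⋆-cong e e′ .at x = sum-cong-≗ λ y → cong₂ ℤ._*_ (e .at y) (e′ .at (y ⁻¹ ∙ x))

  ⋆-comm : ∀ f g → f ⋆ g ≈ g ⋆ f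
  ⋆-comm f g .at x = begin
    sum (λ y → f ⟨ y ⟩ ℤ.* g ⟨ y ⁻¹ ∙ x ⟩)
      ≡⟨ sum-reflect x _ ⟩
    sum (λ y → f ⟨ y ⁻¹ ∙ x ⟩ ℤ.* g ⟨ (y ⁻¹ ∙ x) ⁻¹ ∙ x ⟩)
      ≡⟨ sum-cong-≗ (λ y → trans (cong (λ z → f ⟨ y ⁻¹ ∙ x ⟩ ℤ.* g ⟨ z ⟩) (reflect-involutive x y))
                                 (ℤₚ.*-comm (f ⟨ y ⁻¹ ∙ x ⟩) (g ⟨ y ⟩))) ⟩
    sum (λ y → g ⟨ y ⟩ ℤ.* f ⟨ y ⁻¹ ∙ x ⟩) ∎
    where open ≡-Reasoning

  ⋆-assoc : ∀ f g h → (f ⋆ g) ⋆ h ≈ f ⋆ (g ⋆ h)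
  ⋆-assoc f g h .at x = begin
    sum (λ y → sum (λ z → f ⟨ z ⟩ ℤ.* g ⟨ z ⁻¹ ∙ y ⟩) ℤ.* h ⟨ y ⁻¹ ∙ x ⟩)
      ≡⟨ sum-cong-≗ (λ y → *-distribʳ-sum (h ⟨ y ⁻¹ ∙ x ⟩) (λ z → f ⟨ z ⟩ ℤ.* g ⟨ z ⁻¹ ∙ y ⟩)) ⟩
    sum (λ y → sum (λ z → f ⟨ z ⟩ ℤ.* g ⟨ z ⁻¹ ∙ y ⟩ ℤ.* h ⟨ y ⁻¹ ∙ x ⟩))
      ≡⟨ ∑-comm (λ y z → f ⟨ z ⟩ ℤ.* g ⟨ z ⁻¹ ∙ y ⟩ ℤ.* h ⟨ y ⁻¹ ∙ x ⟩) ⟩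
    sum (λ z → sum (λ y → f ⟨ z ⟩ ℤ.* g ⟨ z ⁻¹ ∙ y ⟩ ℤ.* h ⟨ y ⁻¹ ∙ x ⟩))
      ≡⟨ sum-cong-≗ (λ z → trans (sum-shift z _) (sum-cong-≗ (λ w →
           trans (ℤₚ.*-assoc (f ⟨ z ⟩) (g ⟨ z ⁻¹ ∙ (z ∙ w) ⟩) (h ⟨ (z ∙ w) ⁻¹ ∙ x ⟩))
           (cong₂ (λ a b → f ⟨ z ⟩ ℤ.* (g ⟨ a ⟩ ℤ.* h ⟨ b ⟩)) (\\-leftDividesʳ z w) (swap z w))))) ⟩
    sum (λ z → sum (λ w → f ⟨ z ⟩ ℤ.* (g ⟨ w ⟩ ℤ.* h ⟨ w ⁻¹ ∙ (z ⁻¹ ∙ x) ⟩)))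
      ≡⟨ sum-cong-≗ (λ z → *-distribˡ-sum (f ⟨ z ⟩) (λ w → g ⟨ w ⟩ ℤ.* h ⟨ w ⁻¹ ∙ (z ⁻¹ ∙ x) ⟩)) ⟨
    sum (λ z → f ⟨ z ⟩ ℤ.* sum (λ w → g ⟨ w ⟩ ℤ.* h ⟨ w ⁻¹ ∙ (z ⁻¹ ∙ x) ⟩)) ∎
    where
    open ≡-Reasoning
    swap : ∀ z w → (z ∙ w) ⁻¹ ∙ x ≡ w ⁻¹ ∙ (z ⁻¹ ∙ x)
    swap z w = trans (cong (_∙ x) (trans (cong _⁻¹ (comm z w)) (sym (⁻¹-∙-comm w z)))) (assoc _ _ _)

  ⋆-identityˡ : ∀ f → [ ε ] ⋆ f ≈ f
  ⋆-identityˡ f .at x = trans ([]-⋆ ε f x) (cong (f ⟨_⟩) (trans (cong (_∙ x) ε⁻¹≈ε) (identityˡ x)))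

  ⋆-distribʳ : ∀ f g h → (g ⊕ h) ⋆ f ≈ (g ⋆ f) ⊕ (h ⋆ f)
  ⋆-distribʳ f g h .at x = trans
    (sum-cong-≗ (λ y → ℤₚ.*-distribʳ-+ (f ⟨ y ⁻¹ ∙ x ⟩) (g ⟨ y ⟩) (h ⟨ y ⟩)))
    (∑-distrib-+ (λ y → g ⟨ y ⟩ ℤ.* f ⟨ y ⁻¹ ∙ x ⟩) (λ y → h ⟨ y ⟩ ℤ.* f ⟨ y ⁻¹ ∙ x ⟩))

  ≈-refl : ∀ {f} → f ≈ f
  ≈-refl .at x = refl

  ≈-sym : ∀ {f g} → f ≈ g → g ≈ f
  ≈-sym e .at x = sym (e .at x)

  ≈-trans : ∀ {f g h} → f ≈ g → g ≈ h → f ≈ h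
  ≈-trans e e′ .at x = trans (e .at x) (e′ .at x)

  ⊕-cong : ∀ {f f′ g g′} → f ≈ f′ → g ≈ g′ → f ⊕ g ≈ f′ ⊕ g′
  ⊕-cong e e′ .at x = cong₂ ℤ._+_ (e .at x) (e′ .at x)

  groupRing : CommutativeRing 0ℓ 0ℓ
  groupRing = record
    { Carrier = ℤ[G] ; _≈_ = _≈_ ; _+_ = _⊕_ ; _*_ = _⋆_ ; -_ = ⊖_ ; 0# = 𝟘 ; 1# = [ ε ]
    ; isCommutativeRing = record
      { isRing = record
        { +-isAbelianGroup = record
          { isGroup = record
            { isMonoid = record
              { isSemigroup = record
                { isMagma = record
                  { isEquivalence = record { refl = ≈-refl ; sym = ≈-sym ; trans = ≈-trans }
                  ; ∙-cong = ⊕-cong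
                  }
                ; assoc = λ f g h → pointwise λ x → ℤₚ.+-assoc (f ⟨ x ⟩) (g ⟨ x ⟩) (h ⟨ x ⟩)
                }
              ; identity = (λ f → pointwise λ x → ℤₚ.+-identityˡ (f ⟨ x ⟩))
                         , (λ f → pointwise λ x → ℤₚ.+-identityʳ (f ⟨ x ⟩))
              }
            ; inverse = (λ f → pointwise λ x → ℤₚ.+-inverseˡ (f ⟨ x ⟩))
                      , (λ f → pointwise λ x → ℤₚ.+-inverseʳ (f ⟨ x ⟩))
            ; ⁻¹-cong = λ e → pointwise λ x → cong ℤ.-_ (e .at x)
            }
          ; comm = λ f g → pointwise λ x → ℤₚ.+-comm (f ⟨ x ⟩) (g ⟨ x ⟩)
          }
        ; *-cong = ⋆-cong
        ; *-assoc = ⋆-assoc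
        ; *-identity = ⋆-identityˡ , (λ f → ≈-trans (⋆-comm f [ ε ]) (⋆-identityˡ f))
        ; distrib = (λ f g h → ≈-trans (⋆-comm f (g ⊕ h))
                                 (≈-trans (⋆-distribʳ f g h) (⊕-cong (⋆-comm g f) (⋆-comm h f))))
                  , ⋆-distribʳ
        }
      ; *-comm = ⋆-comm
      }
    }

  -- The involution and the cone of sums of squares

  infix 9 _°
  _° : ℤ[G] → ℤ[G]
  (f °) ⟨ x ⟩ = f ⟨ x ⁻¹ ⟩

  °-cong : ∀ {f g} → f ≈ g → f ° ≈ g °
  °-cong e .at x = e .at (x ⁻¹)

  °-involutive : ∀ f → f ° ° ≈ f
  °-involutive f .at x = cong (f ⟨_⟩) (⁻¹-involutive x)

  °-⋆ : ∀ f g → (f ⋆ g) ° ≈ f ° ⋆ g °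
  °-⋆ f g .at x = trans (sum-inv _)
    (sum-cong-≗ λ y → cong (λ z → f ⟨ y ⁻¹ ⟩ ℤ.* g ⟨ z ⟩) (⁻¹-∙-comm (y ⁻¹) x))

  ⋆°-at : ∀ s x → (s ⋆ s °) ⟨ x ⟩ ≡ sum (λ y → s ⟨ y ⟩ ℤ.* s ⟨ x ⁻¹ ∙ y ⟩)
  ⋆°-at s x = sum-cong-≗ λ y → cong (λ z → s ⟨ y ⟩ ℤ.* s ⟨ z ⟩)
    (trans (sym (⁻¹-∙-comm (y ⁻¹) x)) (trans (cong (_∙ x ⁻¹) (⁻¹-involutive y)) (comm y (x ⁻¹))))

  ⋆°-at-ε : ∀ s → (s ⋆ s °) ⟨ ε ⟩ ≡ sum (λ y → s ⟨ y ⟩ ℤ.* s ⟨ y ⟩)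
  ⋆°-at-ε s = trans (⋆°-at s ε) (sum-cong-≗ λ y → cong (λ z → s ⟨ y ⟩ ℤ.* s ⟨ z ⟩)
    (trans (cong (_∙ y) ε⁻¹≈ε) (identityˡ y)))

  -- The Fourier transform of `s ⋆ s °` is the squared modulus of that of `s`, so this cone is an
  -- integral, character-free model of positive semidefiniteness. `resp` closes it under pointwise
  -- equality.
  data SOS : ℤ[G] → Set where
    square : ∀ s → SOS (s ⋆ s °)
    zero   : SOS 𝟘
    add    : ∀ {p q} → SOS p → SOS q → SOS (p ⊕ q)
    resp   : ∀ {p q} → p ≈ q → SOS p → SOS q

  open CommutativeRing groupRing public using (_-_; setoid; ring; commutativeSemiring; *-commutativeSemigroup;
    +-congˡ; +-congʳ; *-congˡ; *-congʳ; +-assoc; +-comm; +-identityʳ; *-identityʳ; -‿cong; -‿inverseˡ; zeroˡ; zeroʳ; distribˡ)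
  open import Algebra.Properties.CommutativeSemigroup *-commutativeSemigroup using (interchange)

  -- By commutativity `(s s°)(t t°) = (s t)(s t)°`, so products of squares are squares.
  SOS-square-⋆ : ∀ s {q} → SOS q → SOS ((s ⋆ s °) ⋆ q)
  SOS-square-⋆ s (square t) = resp (≈-trans (*-congˡ (°-⋆ s t)) (interchange s t (s °) (t °))) (square (s ⋆ t))
  SOS-square-⋆ s zero       = resp (≈-sym (zeroʳ (s ⋆ s °))) zero
  SOS-square-⋆ s (add p q)  = resp (≈-sym (distribˡ _ _ _)) (add (SOS-square-⋆ s p) (SOS-square-⋆ s q))
  SOS-square-⋆ s (resp e p) = resp (*-congˡ e) (SOS-square-⋆ s p)

  SOS-⋆ : ∀ {p q} → SOS p → SOS q → SOS (p ⋆ q)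
  SOS-⋆ (square s) k = SOS-square-⋆ s k
  SOS-⋆ zero       k = resp (≈-sym (zeroˡ _)) zero
  SOS-⋆ (add p q)  k = resp (≈-sym (⋆-distribʳ _ _ _)) (add (SOS-⋆ p k) (SOS-⋆ q k))
  SOS-⋆ (resp e p) k = resp (*-congʳ e) (SOS-⋆ p k)

  [ε]° : [ ε ] ° ≈ [ ε ]
  [ε]° .at x = δ-iff (λ e → trans (sym ε⁻¹≈ε) (trans (cong _⁻¹ e) (⁻¹-involutive x)))
                     (λ e → trans (sym ε⁻¹≈ε) (cong _⁻¹ e))

  SOS-1 : SOS [ ε ]
  SOS-1 = resp (≈-trans (⋆-identityˡ _) [ε]°) (square [ ε ])

  SOS-symmetric : ∀ {p} → SOS p → p ° ≈ p
  SOS-symmetric (square s) = ≈-trans (°-⋆ s (s °)) (≈-trans (⋆-comm _ _) (⋆-cong (°-involutive s) ≈-refl))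
  SOS-symmetric zero       = pointwise λ _ → refl
  SOS-symmetric (add p q)  = pointwise (⊕-cong (SOS-symmetric p) (SOS-symmetric q) .at)
  SOS-symmetric (resp e p) = ≈-trans (°-cong (≈-sym e)) (≈-trans (SOS-symmetric p) e)

  -- The coefficient of `s s°` at the identity is the sum of the squares of the coefficients of `s`.
  SOS-nonneg : ∀ {p} → SOS p → 0ℤ ℤ.≤ p ⟨ ε ⟩
  SOS-nonneg (square s) = subst (0ℤ ℤ.≤_) (sym (⋆°-at-ε s)) (sum-nonneg _ (λ y → 0≤x*x (s ⟨ y ⟩)))
  SOS-nonneg zero       = ℤₚ.≤-refl
  SOS-nonneg (add p q)  = ℤₚ.+-mono-≤ (SOS-nonneg p) (SOS-nonneg q)
  SOS-nonneg (resp e p) = subst (0ℤ ℤ.≤_) (e .at ε) (SOS-nonneg p)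

  sum-⋆ : ∀ f g → sum ((f ⋆ g) ⟨_⟩) ≡ sum (f ⟨_⟩) ℤ.* sum (g ⟨_⟩)
  sum-⋆ f g = begin
    sum (λ x → sum (λ y → f ⟨ y ⟩ ℤ.* g ⟨ y ⁻¹ ∙ x ⟩))
      ≡⟨ ∑-comm (λ x y → f ⟨ y ⟩ ℤ.* g ⟨ y ⁻¹ ∙ x ⟩) ⟩
    sum (λ y → sum (λ x → f ⟨ y ⟩ ℤ.* g ⟨ y ⁻¹ ∙ x ⟩))
      ≡⟨ sum-cong-≗ (λ y → trans (sym (*-distribˡ-sum (f ⟨ y ⟩) (λ x → g ⟨ y ⁻¹ ∙ x ⟩)))
                                 (cong (ℤ._*_ (f ⟨ y ⟩)) (sym (sum-shift (y ⁻¹) (g ⟨_⟩))))) ⟩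
    sum (λ y → f ⟨ y ⟩ ℤ.* sum (g ⟨_⟩))
      ≡⟨ *-distribʳ-sum (sum (g ⟨_⟩)) (f ⟨_⟩) ⟨
    sum (f ⟨_⟩) ℤ.* sum (g ⟨_⟩) ∎
    where open ≡-Reasoning

  -- The augmentation is multiplicative and invariant under `°`, so that of `s s°` is a perfect
  -- square.
  SOS-sum-nonneg : ∀ {p} → SOS p → 0ℤ ℤ.≤ sum (p ⟨_⟩)
  SOS-sum-nonneg (square s) = subst (0ℤ ℤ.≤_)
    (sym (trans (sum-⋆ s (s °)) (cong (ℤ._*_ (sum (s ⟨_⟩))) (sym (sum-inv (s ⟨_⟩)))))) (0≤x*x (sum (s ⟨_⟩)))
  SOS-sum-nonneg zero       = sum-nonneg (𝟘 ⟨_⟩) (λ _ → ℤₚ.≤-refl)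
  SOS-sum-nonneg (add {p} {q} kp kq) = subst (0ℤ ℤ.≤_) (sym (∑-distrib-+ (p ⟨_⟩) (q ⟨_⟩)))
    (ℤₚ.+-mono-≤ (SOS-sum-nonneg kp) (SOS-sum-nonneg kq))
  SOS-sum-nonneg (resp e p) = subst (0ℤ ℤ.≤_) (sum-cong-≗ (e .at)) (SOS-sum-nonneg p)

  sub-add : ∀ Y W → (Y - W) ⊕ W ≈ Y
  sub-add Y W = ≈-trans (+-assoc Y (⊖ W) W) (≈-trans (+-congˡ (-‿inverseˡ W)) (+-identityʳ Y))

  1-ε : [ ε ] ⟨ ε ⟩ ≡ 1ℤ
  1-ε = cong indicator (dec-true (ε ≟ ε) refl)

  SOS-isCone : IsCone groupRing SOS
  SOS-isCone = record { K-resp = resp ; K-+ = add ; K-* = SOS-⋆ ; K-0 = zero ; K-1 = SOS-1 }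

  open Cone groupRing SOS SOS-isCone public
  open import Algebra.Properties.Ring ring using (-‿distribˡ-*; -‿distribʳ-*; -‿involutive)
  open import Algebra.Solver.Ring.NaturalCoefficients.Default commutativeSemiring
    using (solve; _:=_; con; _:+_; _:*_)
  open import Relation.Binary.Reasoning.Setoid setoid

  ≼⇒≤ : ∀ {p q} → p ≼ q → p ⟨ ε ⟩ ℤ.≤ q ⟨ ε ⟩
  ≼⇒≤ (s , ks , e) = ≤-from-diff (e .at ε) (SOS-nonneg ks)

  ι-⋆ : ∀ k p x → (ι k ⋆ p) ⟨ x ⟩ ≡ + k ℤ.* p ⟨ x ⟩
  ι-⋆ zero p x = trans (zeroˡ p .at x) (sym (ℤₚ.*-zeroˡ (p ⟨ x ⟩)))
  ι-⋆ (suc k) p x = trans (⋆-distribʳ p [ ε ] (ι k) .at x)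
    (trans (cong₂ ℤ._+_ (⋆-identityˡ p .at x) (ι-⋆ k p x)) (sym (ℤₚ.suc-* (+ k) (p ⟨ x ⟩))))

  []° : ∀ t → [ t ] ° ≈ [ t ⁻¹ ]
  []° t .at x = δ-iff (λ e → trans (cong _⁻¹ e) (⁻¹-involutive x)) (λ e → trans (sym (⁻¹-involutive t)) (cong _⁻¹ e))

  []-⋆-[] : ∀ s t → [ s ] ⋆ [ t ] ≈ [ s ∙ t ]
  []-⋆-[] s t .at x = trans ([]-⋆ s [ t ] x) (δ-iff
    (λ e → trans (cong (s ∙_) e) (\\-leftDividesˡ s x))
    (λ e → trans (sym (\\-leftDividesʳ s t)) (cong (s ⁻¹ ∙_) e)))

  []-⋆-[]° : ∀ t → [ t ] ⋆ [ t ] ° ≈ [ ε ]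
  []-⋆-[]° t = ≈-trans (*-congˡ ([]° t)) (≈-trans ([]-⋆-[] t (t ⁻¹))
    (pointwise λ x → cong (λ z → δ z x) (inverseʳ t)))

  -- The elements `U t` and the coefficient bounds they give

  U : Fin n → ℤ[G]
  U t = [ t ] ⊕ [ t ] °

  ⋆-U : ∀ p t → (p ⋆ U t) ⟨ ε ⟩ ≡ p ⟨ t ⟩ ℤ.+ p ⟨ t ⁻¹ ⟩
  ⋆-U p t = trans (⋆-comm p (U t) .at ε) (trans (⋆-distribʳ p [ t ] ([ t ] °) .at ε)
    (trans (cong₂ ℤ._+_ (trans ([]-⋆ t p ε) (cong (p ⟨_⟩) (identityʳ (t ⁻¹))))
      (trans (⋆-cong ([]° t) (≈-refl {p}) .at ε) (trans ([]-⋆ (t ⁻¹) p ε)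
        (cong (p ⟨_⟩) (trans (identityʳ _) (⁻¹-involutive t))))))
    (ℤₚ.+-comm (p ⟨ t ⁻¹ ⟩) (p ⟨ t ⟩))))

  °-⊕ : ∀ f g → (f ⊕ g) ° ≈ f ° ⊕ g °
  °-⊕ f g .at x = refl

  SOS-square : ∀ {s s′} → s ° ≈ s′ → SOS (s ⋆ s′)
  SOS-square {s} e = resp (*-congˡ e) (square s)

  U° : ∀ t → U t ° ≈ U t
  U° t = ≈-trans (°-⊕ _ _) (≈-trans (+-congˡ (°-involutive [ t ])) (+-comm _ _))

  SOS-U² : ∀ t → SOS (U t ⋆ U t)
  SOS-U² t = SOS-square (U° t)

  2+U : Fin n → ℤ[G]
  2+U t = ι 2 ⊕ U t

  -- `2 + U_t = (1 + t)(1 + t)°`, because `t t°` is the unit.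
  SOS-2+U : ∀ t → SOS (2+U t)
  SOS-2+U t = resp (begin
    ([ ε ] ⊕ [ t ]) ⋆ ([ ε ] ⊕ [ t ] °)
      ≈⟨ solve 2 (λ x y → (con 1 :+ x) :* (con 1 :+ y) := con 1 :+ (x :+ y) :+ x :* y) ≈-refl [ t ] ([ t ] °) ⟩
    [ ε ] ⊕ U t ⊕ [ t ] ⋆ [ t ] °
      ≈⟨ +-congˡ ([]-⋆-[]° t) ⟩
    [ ε ] ⊕ U t ⊕ [ ε ]
      ≈⟨ solve 1 (λ x → con 1 :+ x :+ con 1 := (con 1 :+ (con 1 :+ con 0)) :+ x) ≈-refl (U t) ⟩
    2+U t ∎)
    (SOS-square (≈-trans (°-⊕ _ _) (+-congʳ [ε]°)))

  -- Given in factored form, which makes positivity immediate; `2-U+U` identifies it with `2 - U_t`.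
  2-U : Fin n → ℤ[G]
  2-U t = ([ ε ] ⊕ ⊖ [ t ]) ⋆ ([ ε ] ⊕ ⊖ ([ t ] °))

  SOS-2-U : ∀ t → SOS (2-U t)
  SOS-2-U t = SOS-square (≈-trans (°-⊕ _ _) (⊕-cong [ε]° (pointwise λ _ → refl)))

  2-U+U : ∀ t → 2-U t ⊕ U t ≈ ι 2
  2-U+U t = begin
    ([ ε ] ⊕ ⊖ x) ⋆ ([ ε ] ⊕ ⊖ y) ⊕ (x ⊕ y)
      ≈⟨ solve 4 (λ x y x′ y′ → (con 1 :+ x′) :* (con 1 :+ y′) :+ (x :+ y)
           := con 1 :+ (x′ :+ x) :+ (y′ :+ y) :+ x′ :* y′) ≈-refl x y (⊖ x) (⊖ y) ⟩
    [ ε ] ⊕ (⊖ x ⊕ x) ⊕ (⊖ y ⊕ y) ⊕ ⊖ x ⋆ ⊖ y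
      ≈⟨ ⊕-cong (⊕-cong (+-congˡ (-‿inverseˡ x)) (-‿inverseˡ y)) neg-neg ⟩
    [ ε ] ⊕ 𝟘 ⊕ 𝟘 ⊕ [ ε ]
      ≈⟨ solve 0 (con 1 :+ con 0 :+ con 0 :+ con 1 := con 1 :+ (con 1 :+ con 0)) ≈-refl ⟩
    ι 2 ∎
    where
    x = [ t ]
    y = [ t ] °
    neg-neg : ⊖ x ⋆ ⊖ y ≈ [ ε ]
    neg-neg = begin
      ⊖ x ⋆ ⊖ y        ≈⟨ -‿distribˡ-* x (⊖ y) ⟨
      ⊖ (x ⋆ ⊖ y)      ≈⟨ -‿cong (-‿distribʳ-* x y) ⟨
      ⊖ (⊖ (x ⋆ y))    ≈⟨ -‿involutive (x ⋆ y) ⟩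
      x ⋆ y            ≈⟨ []-⋆-[]° t ⟩
      [ ε ]            ∎

  -- The difference of squares `4 - U² = (2 - U)(2 + U)` exhibits the slack as a product of cone
  -- elements.
  U²≤4 : ∀ t → U t ⋆ U t ⊕ 2-U t ⋆ 2+U t ≈ ι 4
  U²≤4 t = begin
    u ⋆ u ⊕ q ⋆ (ι 2 ⊕ u)        ≈⟨ +-congˡ (*-congˡ (+-congʳ (2-U+U t))) ⟨
    u ⋆ u ⊕ q ⋆ (q ⊕ u ⊕ u)      ≈⟨ solve 2 (λ u q → u :* u :+ q :* (q :+ u :+ u) := (q :+ u) :* (q :+ u)) ≈-refl u q ⟩
    (q ⊕ u) ⋆ (q ⊕ u)            ≈⟨ ⋆-cong (2-U+U t) (2-U+U t) ⟩
    ι 2 ⋆ ι 2                    ≈⟨ ×1-homo-* 2 2 ⟨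
    ι 4                          ∎
    where
    u = U t
    q = 2-U t

  -- Since `p` is symmetric, `p (2 + U_x)` has coefficient `2 (p(ε) + p(x))` at the identity. With
  -- `SOS-bound⁻`, which uses `2 - U_x`, this gives `|p(x)| ≤ p(ε)`.
  SOS-bound⁺ : ∀ {p} → SOS p → ∀ x → 0ℤ ℤ.≤ p ⟨ ε ⟩ ℤ.+ p ⟨ x ⟩
  SOS-bound⁺ {p} kp x = half (p ⟨ ε ⟩) (p ⟨ x ⟩) (subst (0ℤ ℤ.≤_) eq (SOS-nonneg (SOS-⋆ kp (SOS-2+U x))))
    where
    half : ∀ a b → 0ℤ ℤ.≤ + 2 ℤ.* a ℤ.+ (b ℤ.+ b) → 0ℤ ℤ.≤ a ℤ.+ b
    half a b h = ℤₚ.*-cancelˡ-≤-pos 0ℤ (a ℤ.+ b) (+ 2) (subst (0ℤ ℤ.≤_) (lem a b) h)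
      where
      lem : ∀ a b → + 2 ℤ.* a ℤ.+ (b ℤ.+ b) ≡ + 2 ℤ.* (a ℤ.+ b)
      lem = solve-∀
    eq : (p ⋆ 2+U x) ⟨ ε ⟩ ≡ + 2 ℤ.* p ⟨ ε ⟩ ℤ.+ (p ⟨ x ⟩ ℤ.+ p ⟨ x ⟩)
    eq = trans (distribˡ p (ι 2) (U x) .at ε) (cong₂ ℤ._+_
      (trans (⋆-comm p (ι 2) .at ε) (ι-⋆ 2 p ε))
      (trans (⋆-U p x) (cong (ℤ._+_ (p ⟨ x ⟩)) (SOS-symmetric kp .at x))))

  SOS-bound⁻ : ∀ {p} → SOS p → ∀ x → p ⟨ x ⟩ ℤ.≤ p ⟨ ε ⟩
  SOS-bound⁻ {p} kp x = half (p ⟨ ε ⟩) (p ⟨ x ⟩)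
    (≤-from-diff eq (SOS-nonneg (SOS-⋆ kp (SOS-2-U x))))
    where
    half : ∀ a b → b ℤ.+ b ℤ.≤ + 2 ℤ.* a → b ℤ.≤ a
    half a b h = ℤₚ.*-cancelˡ-≤-pos b a (+ 2) (subst (ℤ._≤ + 2 ℤ.* a) (lem b) h)
      where
      lem : ∀ b → b ℤ.+ b ≡ + 2 ℤ.* b
      lem = solve-∀
    eq : (p ⟨ x ⟩ ℤ.+ p ⟨ x ⟩) ℤ.+ (p ⋆ 2-U x) ⟨ ε ⟩ ≡ + 2 ℤ.* p ⟨ ε ⟩
    eq = trans (cong (ℤ._+ (p ⋆ 2-U x) ⟨ ε ⟩) (sym (trans (⋆-U p x) (cong (ℤ._+_ (p ⟨ x ⟩)) (SOS-symmetric kp .at x)))))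
      (trans (sym (distribˡ p (U x) (2-U x) .at ε))
      (trans (*-congˡ {p} (≈-trans (+-comm (U x) (2-U x)) (2-U+U x)) .at ε) (trans (⋆-comm p (ι 2) .at ε) (ι-⋆ 2 p ε))))

  -- Each of the `n` terms of the convolution at the identity is bounded using `|p| ≤ p(ε)` and
  -- `|q| ≤ q(ε)`. This is the only place where the factor `n` enters the moment estimate.
  SOS-pairing-bound : ∀ {p q} → SOS p → SOS q → (p ⋆ q) ⟨ ε ⟩ ℤ.≤ + n ℤ.* (p ⟨ ε ⟩ ℤ.* q ⟨ ε ⟩)
  SOS-pairing-bound {p} {q} kp kq = subst ((p ⋆ q) ⟨ ε ⟩ ℤ.≤_) (sum-const n (p ⟨ ε ⟩ ℤ.* q ⟨ ε ⟩))
    (sum-mono _ _ λ y → bound (SOS-bound⁺ kp y) (SOS-bound⁻ kp y) (SOS-bound⁺ kq (y ⁻¹ ∙ ε)) (SOS-bound⁻ kq (y ⁻¹ ∙ ε)))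
    where
    -- Uses `2(ac - bd) = (a + b)(c - d) + (a - b)(c + d)`.
    bound : ∀ {a b c d} → 0ℤ ℤ.≤ a ℤ.+ b → b ℤ.≤ a → 0ℤ ℤ.≤ c ℤ.+ d → d ℤ.≤ c → b ℤ.* d ℤ.≤ a ℤ.* c
    bound {a} {b} {c} {d} h₁ h₂ h₃ h₄ = ℤₚ.*-cancelˡ-≤-pos (b ℤ.* d) (a ℤ.* c) (+ 2) (≤-from-diff (lem a b c d)
      (ℤₚ.+-mono-≤ (0≤* h₁ (ℤₚ.i≤j⇒0≤j-i h₄)) (0≤* (ℤₚ.i≤j⇒0≤j-i h₂) h₃)))
      where
      lem : ∀ a b c d → + 2 ℤ.* (b ℤ.* d) ℤ.+ ((a ℤ.+ b) ℤ.* (c ℤ.- d) ℤ.+ (a ℤ.- b) ℤ.* (c ℤ.+ d)) ≡ + 2 ℤ.* (a ℤ.* c)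
      lem = solve-∀

-- The potential Φ and the sets F

module Potential {n : ℕ} (G : FinAbGroup n) (κ j : ℕ) (j<κm : suc j ℕ.≤ κ ℕ.* (2 ℕ.+ j)) where
  open GroupRing G
  open import Algebra.Properties.Ring ring using (+-cancelʳ)
  open import Algebra.Solver.Ring.NaturalCoefficients.Default commutativeSemiring
    using (solve; _:=_; con; _:+_; _:*_)
  open import Relation.Binary.Reasoning.Setoid setoid

  m : ℕ
  m = 2 ℕ.+ j

  k : ℤ[G]
  k = ι κ ⋆ ι m

  κ² : ℤ
  κ² = + κ ℤ.* + κ

  0≤κ² : 0ℤ ℤ.≤ κ²
  0≤κ² = 0≤x*x (+ κ)

  Φ : ℤ[G] → ℤ
  Φ Y = (Y ^ m) ⟨ ε ⟩

  -- With r steps left, Y = 4k - ∑ U_t over k - r values of t, that is, 2k + 2r + ∑ (2 - U_t).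
  record Valid (r : ℕ) (Y : ℤ[G]) : Set where
    constructor valid
    field
      excess     : ℤ[G]
      excess-SOS : SOS excess
      split      : (k ⊕ k) ⊕ (ι r ⊕ ι r ⊕ excess) ≈ Y

  SOS-k : SOS k
  SOS-k = SOS-⋆ (K-ι κ) (K-ι m)

  Valid⇒SOS : ∀ {r Y} → Valid r Y → SOS Y
  Valid⇒SOS {r} (valid z kz e) = resp e (add (add SOS-k SOS-k) (add (add (K-ι r) (K-ι r)) kz))

  -- One of the reserved constants `2` is spent: `2(r + 1) - U_t = 2r + (2 - U_t)`.
  Valid-step : ∀ {r Y} t → Valid (suc r) Y → Valid r (Y - U t)
  Valid-step {r} {Y} t (valid z kz e) = valid (2-U t ⊕ z) (add (SOS-2-U t) kz)
    (+-cancelʳ (U t) _ _ (begin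
      (k ⊕ k) ⊕ (ι r ⊕ ι r ⊕ (2-U t ⊕ z)) ⊕ U t
        ≈⟨ solve 5 (λ k r q z u → (k :+ k) :+ (r :+ r :+ (q :+ z)) :+ u := (k :+ k) :+ (r :+ r :+ z) :+ (q :+ u)) ≈-refl k (ι r) (2-U t) z (U t) ⟩
      (k ⊕ k) ⊕ (ι r ⊕ ι r ⊕ z) ⊕ (2-U t ⊕ U t)
        ≈⟨ +-congˡ (2-U+U t) ⟩
      (k ⊕ k) ⊕ (ι r ⊕ ι r ⊕ z) ⊕ ι 2
        ≈⟨ solve 3 (λ k r z → (k :+ k) :+ (r :+ r :+ z) :+ (con 1 :+ (con 1 :+ con 0))
             := (k :+ k) :+ ((con 1 :+ r) :+ (con 1 :+ r) :+ z)) ≈-refl k (ι r) z ⟩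
      (k ⊕ k) ⊕ (ι (suc r) ⊕ ι (suc r) ⊕ z)
        ≈⟨ e ⟩
      Y
        ≈⟨ sub-add Y (U t) ⟨
      (Y - U t) ⊕ U t ∎))

  -- Supplies the positivity used by `second-order`. As `i ≤ k`, the reserve `2k` absorbs `i U_t`
  -- through `2k + i U_t = i (2 + U_t) + 2 (k - i)`.
  Valid⇒SOS-Y+iU : ∀ {r Y} t → Valid r Y → ∀ i → i ℕ.≤ suc j → SOS (Y ⊕ ι i ⋆ U t)
  Valid⇒SOS-Y+iU {r} {Y} t (valid z kz e) i i≤ = resp (begin
      (ι i ⋆ (ι 2 ⊕ U t) ⊕ (ι d ⊕ ι d)) ⊕ (ι r ⊕ ι r ⊕ z)
        ≈⟨ solve 4 (λ i d u r → (i :* ((con 1 :+ (con 1 :+ con 0)) :+ u) :+ (d :+ d)) :+ r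
             := (((i :+ d) :+ (i :+ d)) :+ r) :+ i :* u) ≈-refl (ι i) (ι d) (U t) (ι r ⊕ ι r ⊕ z) ⟩
      ((ι i ⊕ ι d) ⊕ (ι i ⊕ ι d)) ⊕ (ι r ⊕ ι r ⊕ z) ⊕ ι i ⋆ U t
        ≈⟨ +-congʳ (+-congʳ (⊕-cong i+d i+d)) ⟩
      (k ⊕ k) ⊕ (ι r ⊕ ι r ⊕ z) ⊕ ι i ⋆ U t
        ≈⟨ +-congʳ e ⟩
      Y ⊕ ι i ⋆ U t ∎)
    (add (add (SOS-⋆ (K-ι i) (SOS-2+U t)) (add (K-ι d) (K-ι d))) (add (add (K-ι r) (K-ι r)) kz))
    where
    d = κ ℕ.* m ℕ.∸ i
    i+d : ι i ⊕ ι d ≈ k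
    i+d = begin
      ι i ⊕ ι d          ≈⟨ ×-homo-+ [ ε ] i d ⟨
      ι (i ℕ.+ d)        ≡⟨ cong ι (ℕₚ.m+[n∸m]≡n (ℕₚ.≤-trans i≤ j<κm)) ⟩
      ι (κ ℕ.* m)        ≈⟨ ×1-homo-* κ m ⟩
      k                  ∎

  κ²-⋆ : ∀ p → (ι κ ⋆ ι κ ⋆ p) ⟨ ε ⟩ ≡ κ² ℤ.* p ⟨ ε ⟩
  κ²-⋆ p = trans (⋆-assoc (ι κ) (ι κ) p .at ε) (trans (ι-⋆ κ (ι κ ⋆ p) ε)
    (trans (cong (ℤ._*_ (+ κ)) (ι-⋆ κ p ε)) (sym (ℤₚ.*-assoc (+ κ) (+ κ) (p ⟨ ε ⟩)))))

  Φ-step : ∀ {r Y} t → Valid (suc r) Y → let P = Y ^ suc j in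
    κ² ℤ.* Φ (Y - U t) ℤ.+ κ² ℤ.* (+ m ℤ.* (P ⟨ t ⟩ ℤ.+ P ⟨ t ⁻¹ ⟩)) ℤ.≤ (κ² ℤ.+ 1ℤ) ℤ.* Φ Y
  Φ-step {r} {Y} t v@(valid z kz e) = subst₂ ℤ._≤_
    (cong₂ ℤ._+_ (κ²-⋆ ((Y - U t) ^ m)) (trans (κ²-⋆ (ι m ⋆ (Y ^ suc j ⋆ U t))) (cong (ℤ._*_ κ²) (trans (ι-⋆ m (Y ^ suc j ⋆ U t) ε) (cong (ℤ._*_ (+ m)) (⋆-U (Y ^ suc j) t))))))
    (trans (⋆-distribʳ (Y ^ m) (ι κ ⋆ ι κ) [ ε ] .at ε)
      (trans (cong₂ ℤ._+_ (κ²-⋆ (Y ^ m)) (⋆-identityˡ (Y ^ m) .at ε)) (lem κ² (Φ Y))))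
    (≼⇒≤ (growth j (Valid⇒SOS v) (add (add (K-ι (suc r)) (K-ι (suc r))) kz) (SOS-⋆ (SOS-2-U t) (SOS-2+U t)) (K-ι κ)
      (Valid⇒SOS (Valid-step t v)) (SOS-U² t) (sub-add Y (U t)) e (U²≤4 t) (Valid⇒SOS-Y+iU t v)))
    where
    lem : ∀ a b → a ℤ.* b ℤ.+ b ≡ (a ℤ.+ 1ℤ) ℤ.* b
    lem = solve-∀

  -- Summing `Φ-step` over `t` turns the first-order terms into a nonnegative multiple of the
  -- augmentation of `Y^(m-1)`, which is then dropped.
  Φ-average : ∀ {r Y} → Valid (suc r) Y →
    sum (λ t → κ² ℤ.* Φ (Y - U t)) ℤ.≤ + n ℤ.* ((κ² ℤ.+ 1ℤ) ℤ.* Φ Y)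
  Φ-average {r} {Y} v = ℤₚ.≤-trans
    (≤-from-diff refl (0≤* 0≤κ² (0≤* {+ m} (ℤ.+≤+ z≤n) (ℤₚ.+-mono-≤ 0≤∑P 0≤∑P))))
    (subst₂ ℤ._≤_
      (trans (∑-distrib-+ (λ t → κ² ℤ.* Φ (Y - U t)) (λ t → κ² ℤ.* (+ m ℤ.* (P ⟨ t ⟩ ℤ.+ P ⟨ t ⁻¹ ⟩))))
        (cong (ℤ._+_ (sum (λ t → κ² ℤ.* Φ (Y - U t)))) ∑P))
      (sum-const n ((κ² ℤ.+ 1ℤ) ℤ.* Φ Y))
      (sum-mono _ _ (λ t → Φ-step t v)))
    where
    P = Y ^ suc j
    0≤∑P : 0ℤ ℤ.≤ sum (P ⟨_⟩)
    0≤∑P = SOS-sum-nonneg (K-^ (suc j) (Valid⇒SOS v))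
    ∑P : sum (λ t → κ² ℤ.* (+ m ℤ.* (P ⟨ t ⟩ ℤ.+ P ⟨ t ⁻¹ ⟩))) ≡ κ² ℤ.* (+ m ℤ.* (sum (P ⟨_⟩) ℤ.+ sum (P ⟨_⟩)))
    ∑P = trans (sym (*-distribˡ-sum κ² (λ t → + m ℤ.* (P ⟨ t ⟩ ℤ.+ P ⟨ t ⁻¹ ⟩))))
      (cong (ℤ._*_ κ²) (trans (sym (*-distribˡ-sum (+ m) (λ t → P ⟨ t ⟩ ℤ.+ P ⟨ t ⁻¹ ⟩)))
        (cong (ℤ._*_ (+ m)) (trans (∑-distrib-+ (P ⟨_⟩) (λ t → P ⟨ t ⁻¹ ⟩)) (cong (ℤ._+_ (sum (P ⟨_⟩))) (sym (sum-inv (P ⟨_⟩))))))))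

  Flat : ℤ[G] → Fin n → Set
  Flat Y t = κ² ℤ.* Φ (Y - U t) ℤ.≤ (κ² ℤ.+ + 2) ℤ.* Φ Y

  flat? : ∀ Y t → Dec (Flat Y t)
  flat? Y t = κ² ℤ.* Φ (Y - U t) ℤ.≤? (κ² ℤ.+ + 2) ℤ.* Φ Y

  -- The translate by `c` of the set of flat elements; it depends on `c` and `Y` alone.
  F : Fin n → ℤ[G] → Subset n
  F c Y = tabulate (λ x → does (flat? Y (c ⁻¹ ∙ x)))

  ∈F⇒Flat : ∀ {c Y x} → x ∈ F c Y → Flat Y (c ⁻¹ ∙ x)
  ∈F⇒Flat {c} {Y} {x} x∈F with flat? Y (c ⁻¹ ∙ x) | trans (sym (lookup∘tabulate (λ x → does (flat? Y (c ⁻¹ ∙ x))) x)) ([]=⇒lookup x∈F)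
  ... | yes p | _ = p

  -- A remaining step leaves a unit inside `Y`, hence `1 ≼ Y ≼ Y^m` on the identity coefficient.
  -- This lets `Φ` be cancelled in `F-large`.
  Φ-positive : ∀ {r Y} → Valid (suc r) Y → 1ℤ ℤ.≤ Φ Y
  Φ-positive {r} {Y} (valid z kz e) = subst (ℤ._≤ Φ Y) 1-ε (≼⇒≤ (1≼^ m
    (k ⊕ k ⊕ (ι r ⊕ ι (suc r) ⊕ z) , add (add SOS-k SOS-k) (add (add (K-ι r) (K-ι (suc r))) kz) ,
    ≈-trans (solve 3 (λ k r z → con 1 :+ (k :+ k :+ (r :+ (con 1 :+ r) :+ z)) := k :+ k :+ ((con 1 :+ r) :+ (con 1 :+ r) :+ z)) ≈-refl k (ι r) z) e)))

  -- Markov's inequality: every non-flat `t` contributes at least `(κ² + 2) Φ` to a total of at most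
  -- `n (κ² + 1) Φ`.
  F-large : ∀ {r Y} c → Valid (suc r) Y → n ℕ.≤ ∣ F c Y ∣ ℕ.* (κ ℕ.* κ ℕ.+ 2)
  F-large {r} {Y} c v = ℤ.drop‿+≤+ (subst (+ n ℤ.≤_) pos-eq (cancel (+ n) (+ ∣ F c Y ∣) κ² (Φ Y) (Φ-positive v)
      (ℤₚ.≤-trans (subst₂ ℤ._≤_ (sum-const n ((κ² ℤ.+ + 2) ℤ.* Φ Y))
         (trans (∑-distrib-+ (λ x → κ² ℤ.* Φ (Y - U (c ⁻¹ ∙ x))) (λ x → (κ² ℤ.+ + 2) ℤ.* Φ Y ℤ.* indicator (lookup (F c Y) x)))
           (cong₂ ℤ._+_ (sym (sum-shift (c ⁻¹) (λ t → κ² ℤ.* Φ (Y - U t))))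
             (trans (sym (*-distribˡ-sum ((κ² ℤ.+ + 2) ℤ.* Φ Y) (λ x → indicator (lookup (F c Y) x))))
               (cong (ℤ._*_ ((κ² ℤ.+ + 2) ℤ.* Φ Y)) (sym (card-sum (F c Y)))))))
         (sum-mono _ _ markov))
         (ℤₚ.+-monoˡ-≤ ((κ² ℤ.+ + 2) ℤ.* Φ Y ℤ.* + ∣ F c Y ∣) (Φ-average v)))))
    where
    pos-eq : + ∣ F c Y ∣ ℤ.* (κ² ℤ.+ + 2) ≡ + (∣ F c Y ∣ ℕ.* (κ ℕ.* κ ℕ.+ 2))
    pos-eq = trans (cong (λ z → + ∣ F c Y ∣ ℤ.* (z ℤ.+ + 2)) (sym (ℤₚ.pos-* κ κ))) (sym (ℤₚ.pos-* ∣ F c Y ∣ (κ ℕ.* κ ℕ.+ 2)))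
    -- Inside `F` the indicator term suffices, as the new potential is nonnegative; outside,
    -- non-flatness suffices.
    markov : ∀ x → (κ² ℤ.+ + 2) ℤ.* Φ Y ℤ.≤ κ² ℤ.* Φ (Y - U (c ⁻¹ ∙ x)) ℤ.+ (κ² ℤ.+ + 2) ℤ.* Φ Y ℤ.* indicator (lookup (F c Y) x)
    markov x with lookup (F c Y) x | lookup∘tabulate (λ x → does (flat? Y (c ⁻¹ ∙ x))) x
    ... | b | eq with flat? Y (c ⁻¹ ∙ x)
    markov x | .true | refl | yes p = inside ((κ² ℤ.+ + 2) ℤ.* Φ Y)
      (0≤* 0≤κ² (SOS-nonneg (K-^ m (Valid⇒SOS (Valid-step (c ⁻¹ ∙ x) v)))))
      where
      inside : ∀ a {b} → 0ℤ ℤ.≤ b → a ℤ.≤ b ℤ.+ a ℤ.* 1ℤ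
      inside a {b} = ≤-from-diff (lem a b)
        where
        lem : ∀ a b → a ℤ.+ b ≡ b ℤ.+ a ℤ.* 1ℤ
        lem = solve-∀
    markov x | .false | refl | no ¬p = outside ((κ² ℤ.+ + 2) ℤ.* Φ Y) (ℤₚ.<⇒≤ (ℤₚ.≰⇒> ¬p))
      where
      outside : ∀ a {b} → a ℤ.≤ b → a ℤ.≤ b ℤ.+ a ℤ.* 0ℤ
      outside a {b} h = subst (a ℤ.≤_) (lem a b) h
        where
        lem : ∀ a b → b ≡ b ℤ.+ a ℤ.* 0ℤ
        lem = solve-∀
    cancel : ∀ n f κ² Φ → 1ℤ ℤ.≤ Φ → n ℤ.* ((κ² ℤ.+ + 2) ℤ.* Φ) ℤ.≤ n ℤ.* ((κ² ℤ.+ 1ℤ) ℤ.* Φ) ℤ.+ (κ² ℤ.+ + 2) ℤ.* Φ ℤ.* f →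
      n ℤ.≤ f ℤ.* (κ² ℤ.+ + 2)
    cancel n f κ² (+ suc Φ) (ℤ.+≤+ _) h = ℤₚ.*-cancelʳ-≤-pos n (f ℤ.* (κ² ℤ.+ + 2)) (+ suc Φ)
      (ℤₚ.0≤i-j⇒j≤i (subst (0ℤ ℤ.≤_) (lem n f κ² (+ suc Φ)) (ℤₚ.i≤j⇒0≤j-i h)))
      where
      lem : ∀ n f κ² Φ → n ℤ.* ((κ² ℤ.+ 1ℤ) ℤ.* Φ) ℤ.+ (κ² ℤ.+ + 2) ℤ.* Φ ℤ.* f ℤ.- n ℤ.* ((κ² ℤ.+ + 2) ℤ.* Φ)
        ≡ f ℤ.* (κ² ℤ.+ + 2) ℤ.* Φ ℤ.- n ℤ.* Φ
      lem = solve-∀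

length-concat-tabulate : ∀ {A : Set} {n b} (f : Fin n → List A) → (∀ i → length (f i) ℕ.≤ b) →
  length (concat (List.tabulate f)) ℕ.≤ n ℕ.* b
length-concat-tabulate {n = zero}  f h = z≤n
length-concat-tabulate {n = suc n} f h = ℕₚ.≤-trans (ℕₚ.≤-reflexive (length-++ (f zero)))
  (ℕₚ.+-mono-≤ (h zero) (length-concat-tabulate (f ∘ suc) (h ∘ suc)))

-- The integer arithmetic behind `moment-bound`: the first two estimates give `c C w ≤ q`, the third
-- bounds `q`, and the positive `w` cancels.
tangent-bound : ∀ e {c C w ψ q N Φ : ℤ} → 0ℤ ℤ.≤ C → 1ℤ ℤ.≤ w → c ℤ.* w ℤ.≤ ψ →
  + suc e ℤ.* (C ℤ.* ψ) ℤ.≤ q ℤ.+ + e ℤ.* (c ℤ.* C ℤ.* w) → q ℤ.≤ N ℤ.* (w ℤ.* Φ) →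
  c ℤ.* C ℤ.≤ N ℤ.* Φ
tangent-bound e {c} {C} {w@(+ suc _)} {ψ} {q} {N} {Φ} 0≤C (ℤ.+≤+ _) h₁ h₂ h₃ =
  ℤₚ.*-cancelʳ-≤-pos (c ℤ.* C) (N ℤ.* Φ) w (≤-from-diff (lem (+ e) c C w ψ q N Φ)
    (ℤₚ.+-mono-≤ (ℤₚ.+-mono-≤ (ℤₚ.i≤j⇒0≤j-i h₃) (ℤₚ.i≤j⇒0≤j-i h₂))
      (0≤* {+ suc e} (ℤ.+≤+ z≤n) (0≤* 0≤C (ℤₚ.i≤j⇒0≤j-i h₁)))))
  where
  lem : ∀ e c C w ψ q N Φ → c ℤ.* C ℤ.* w ℤ.+
    (((N ℤ.* (w ℤ.* Φ) ℤ.- q) ℤ.+ (q ℤ.+ e ℤ.* (c ℤ.* C ℤ.* w) ℤ.- (1ℤ ℤ.+ e) ℤ.* (C ℤ.* ψ)))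
      ℤ.+ (1ℤ ℤ.+ e) ℤ.* (C ℤ.* (ψ ℤ.- c ℤ.* w))) ≡ N ℤ.* Φ ℤ.* w
  lem = solve-∀

-- Lower bounds for power moments

module Moments {n : ℕ} (G : FinAbGroup n) where
  open GroupRing G

  ι^-⋆ : ∀ c e p x → (ι c ^ e ⋆ p) ⟨ x ⟩ ≡ + (c ℕ.^ e) ℤ.* p ⟨ x ⟩
  ι^-⋆ c zero    p x = trans (⋆-identityˡ p .at x) (sym (ℤₚ.*-identityˡ (p ⟨ x ⟩)))
  ι^-⋆ c (suc e) p x = begin
    (ι c ⋆ ι c ^ e ⋆ p) ⟨ x ⟩              ≡⟨ ⋆-assoc (ι c) (ι c ^ e) p .at x ⟩
    (ι c ⋆ (ι c ^ e ⋆ p)) ⟨ x ⟩            ≡⟨ ι-⋆ c (ι c ^ e ⋆ p) x ⟩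
    + c ℤ.* (ι c ^ e ⋆ p) ⟨ x ⟩            ≡⟨ cong (ℤ._*_ (+ c)) (ι^-⋆ c e p x) ⟩
    + c ℤ.* (+ (c ℕ.^ e) ℤ.* p ⟨ x ⟩)      ≡⟨ ℤₚ.*-assoc (+ c) (+ (c ℕ.^ e)) (p ⟨ x ⟩) ⟨
    + c ℤ.* + (c ℕ.^ e) ℤ.* p ⟨ x ⟩        ≡⟨ cong (ℤ._* p ⟨ x ⟩) (ℤₚ.pos-* c (c ℕ.^ e)) ⟨
    + (c ℕ.^ suc e) ℤ.* p ⟨ x ⟩            ∎
    where open ≡-Reasoning

  -- `Y - c` is fixed by `°`, so its square is of the form `s s°`.
  2Yc≼Y²+c² : ∀ {Y c} → SOS Y → SOS c → Y ⋆ c ⊕ Y ⋆ c ≼ Y ⋆ Y ⊕ c ⋆ c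
  2Yc≼Y²+c² {Y} {c} kY kc = D ⋆ D , SOS-square D° , expand
    where
    open import Algebra.Solver.Ring.NaturalCoefficients.Default commutativeSemiring
      using (solve; _:=_; con; _:+_; _:*_)
    open import Relation.Binary.Reasoning.Setoid setoid
    D = Y - c
    D° : D ° ≈ D
    D° = ≈-trans (°-⊕ Y (⊖ c)) (⊕-cong (SOS-symmetric kY) (≈-trans (pointwise λ _ → refl) (-‿cong (SOS-symmetric kc))))
    D+c : D ⊕ c ≈ Y
    D+c = sub-add Y c
    expand : Y ⋆ c ⊕ Y ⋆ c ⊕ D ⋆ D ≈ Y ⋆ Y ⊕ c ⋆ c
    expand = begin
      Y ⋆ c ⊕ Y ⋆ c ⊕ D ⋆ D
        ≈⟨ +-congʳ (⊕-cong (*-congʳ D+c) (*-congʳ D+c)) ⟨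
      (D ⊕ c) ⋆ c ⊕ (D ⊕ c) ⋆ c ⊕ D ⋆ D
        ≈⟨ solve 2 (λ D c → (D :+ c) :* c :+ (D :+ c) :* c :+ D :* D := (D :+ c) :* (D :+ c) :+ c :* c) ≈-refl D c ⟩
      (D ⊕ c) ⋆ (D ⊕ c) ⊕ c ⋆ c
        ≈⟨ +-congʳ (⋆-cong D+c D+c) ⟩
      Y ⋆ Y ⊕ c ⋆ c ∎

  ⋆-≼ : ∀ {p x y} → SOS p → x ≼ y → (p ⋆ x) ⟨ ε ⟩ ℤ.≤ (p ⋆ y) ⟨ ε ⟩
  ⋆-≼ {p} {x} {y} kp (s , ks , e) = ≼⇒≤ (p ⋆ s , SOS-⋆ kp ks , ≈-trans (≈-sym (distribˡ p x s)) (*-congˡ e))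

  -- Jensen's inequality with `w` as an unnormalised state: the tangent to the power at `c` yields
  -- `c^(e+1) w(ε) ≤ (w Y^(e+1))(ε)`, and `SOS-pairing-bound` removes `w`.
  moment-bound : ∀ {w Y c} → SOS w → SOS Y → 1ℤ ℤ.≤ w ⟨ ε ⟩ → + c ℤ.* w ⟨ ε ⟩ ℤ.≤ (w ⋆ Y) ⟨ ε ⟩ →
    ∀ e → + (c ℕ.^ suc e) ℤ.≤ + n ℤ.* (Y ^ suc e) ⟨ ε ⟩
  moment-bound {w} {Y} {c} kw kY 1≤w h e = subst (ℤ._≤ + n ℤ.* (Y ^ suc e) ⟨ ε ⟩) (sym (ℤₚ.pos-* c (c ℕ.^ e)))
    (tangent-bound e {+ c} {C} {w ⟨ ε ⟩} {ψY} {(w ⋆ Y ^ suc e) ⟨ ε ⟩} {+ n} {(Y ^ suc e) ⟨ ε ⟩} (ℤ.+≤+ z≤n) 1≤w h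
      (subst₂ ℤ._≤_ lhs rhs (⋆-≼ kw (bernoulli kY (K-ι c) (2Yc≼Y²+c² kY (K-ι c)) e)))
      (SOS-pairing-bound kw (K-^ (suc e) kY)))
    where
    ψY = (w ⋆ Y) ⟨ ε ⟩
    C = + (c ℕ.^ e)
    swap : ∀ (s p : ℤ[G]) → w ⋆ (s ⋆ p) ≈ s ⋆ (w ⋆ p)
    swap s p = ≈-trans (≈-sym (⋆-assoc w s p)) (≈-trans (*-congʳ (⋆-comm w s)) (⋆-assoc s w p))
    lhs : (w ⋆ (ι (suc e) ⋆ (ι c ^ e ⋆ Y))) ⟨ ε ⟩ ≡ + suc e ℤ.* (C ℤ.* ψY)
    lhs = trans (swap (ι (suc e)) (ι c ^ e ⋆ Y) .at ε) (trans (ι-⋆ (suc e) (w ⋆ (ι c ^ e ⋆ Y)) ε)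
      (cong (ℤ._*_ (+ suc e)) (trans (swap (ι c ^ e) Y .at ε) (ι^-⋆ c e (w ⋆ Y) ε))))
    rhs : (w ⋆ (Y ^ suc e ⊕ ι e ⋆ ι c ^ suc e)) ⟨ ε ⟩ ≡ (w ⋆ Y ^ suc e) ⟨ ε ⟩ ℤ.+ + e ℤ.* (+ c ℤ.* C ℤ.* w ⟨ ε ⟩)
    rhs = trans (distribˡ w (Y ^ suc e) (ι e ⋆ ι c ^ suc e) .at ε) (cong (ℤ._+_ ((w ⋆ Y ^ suc e) ⟨ ε ⟩))
      (trans (swap (ι e) (ι c ^ suc e) .at ε) (trans (ι-⋆ e (w ⋆ ι c ^ suc e) ε)
        (cong (ℤ._*_ (+ e)) (trans (⋆-comm w (ι c ^ suc e) .at ε) (trans (ι^-⋆ c (suc e) w ε) (cong (ℤ._* w ⟨ ε ⟩) (ℤₚ.pos-* c (c ℕ.^ e)))))))))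

-- Centring the indicator f of a set: h has sum zero, and its autocorrelation w is negative at
-- every t that is not a quotient of two elements of the set.
module Bias {n : ℕ} (G : FinAbGroup n) (f : Fin n → ℤ) (f-idem : ∀ x → f x ℤ.* f x ≡ f x) where
  open GroupRing G

  a : ℤ
  a = sum f

  Avoids : Fin n → Set
  Avoids t = ∀ y → f y ℤ.* f (t ⁻¹ ∙ y) ≡ 0ℤ

  avoids? : ∀ t → Dec (Avoids t)
  avoids? t = all? (λ y → f y ℤ.* f (t ⁻¹ ∙ y) ℤ.≟ 0ℤ)

  -- Scaling the centred indicator by `n` keeps it integral.
  h w : ℤ[G]
  h ⟨ y ⟩ = + n ℤ.* f y ℤ.- a
  w = h ⋆ h °

  -- One expansion gives both values of `w` in use: `g = f` for the identity, and a translate of `f`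
  -- for `t`.
  centred-product : ∀ g → sum g ≡ a →
    sum (λ y → (+ n ℤ.* f y ℤ.- a) ℤ.* (+ n ℤ.* g y ℤ.- a)) ≡ + n ℤ.* (+ n ℤ.* sum (λ y → f y ℤ.* g y) ℤ.- a ℤ.* a)
  centred-product g ∑g = begin
    sum (λ y → (N ℤ.* f y ℤ.- a) ℤ.* (N ℤ.* g y ℤ.- a))
      ≡⟨ sum-cong-≗ (λ y → lem₁ N (f y) (g y) a) ⟩
    sum (λ y → N ℤ.* N ℤ.* (f y ℤ.* g y) ℤ.+ (ℤ.- (N ℤ.* a) ℤ.* (f y ℤ.+ g y) ℤ.+ a ℤ.* a))
      ≡⟨ trans (∑-distrib-+ (λ y → N ℤ.* N ℤ.* (f y ℤ.* g y)) _)
           (cong₂ ℤ._+_ (sym (*-distribˡ-sum (N ℤ.* N) (λ y → f y ℤ.* g y)))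
             (trans (∑-distrib-+ (λ y → ℤ.- (N ℤ.* a) ℤ.* (f y ℤ.+ g y)) (λ _ → a ℤ.* a))
               (cong₂ ℤ._+_ (trans (sym (*-distribˡ-sum (ℤ.- (N ℤ.* a)) (λ y → f y ℤ.+ g y)))
                                   (cong (ℤ._*_ (ℤ.- (N ℤ.* a))) (trans (∑-distrib-+ f g) (cong (ℤ._+_ a) ∑g))))
                            (sum-const n (a ℤ.* a))))) ⟩
    N ℤ.* N ℤ.* S ℤ.+ (ℤ.- (N ℤ.* a) ℤ.* (a ℤ.+ a) ℤ.+ N ℤ.* (a ℤ.* a))
      ≡⟨ lem₂ N S a ⟩
    N ℤ.* (N ℤ.* S ℤ.- a ℤ.* a) ∎
    where
    open ≡-Reasoning
    N = + n
    S = sum (λ y → f y ℤ.* g y)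
    lem₁ : ∀ N f g a → (N ℤ.* f ℤ.- a) ℤ.* (N ℤ.* g ℤ.- a) ≡ N ℤ.* N ℤ.* (f ℤ.* g) ℤ.+ (ℤ.- (N ℤ.* a) ℤ.* (f ℤ.+ g) ℤ.+ a ℤ.* a)
    lem₁ = solve-∀
    lem₂ : ∀ N S a → N ℤ.* N ℤ.* S ℤ.+ (ℤ.- (N ℤ.* a) ℤ.* (a ℤ.+ a) ℤ.+ N ℤ.* (a ℤ.* a)) ≡ N ℤ.* (N ℤ.* S ℤ.- a ℤ.* a)
    lem₂ = solve-∀

  w-ε : w ⟨ ε ⟩ ≡ + n ℤ.* (+ n ℤ.* a ℤ.- a ℤ.* a)
  w-ε = trans (⋆°-at-ε h) (trans (centred-product f refl)
    (cong (λ z → + n ℤ.* (+ n ℤ.* z ℤ.- a ℤ.* a)) (sum-cong-≗ f-idem)))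

  w-avoids : ∀ {t} → Avoids t → w ⟨ t ⟩ ≡ ℤ.- (+ n ℤ.* (a ℤ.* a))
  w-avoids {t} av = trans (⋆°-at h t) (trans (centred-product (λ y → f (t ⁻¹ ∙ y)) (sym (sum-shift (t ⁻¹) f)))
    (trans (cong (λ z → + n ℤ.* (+ n ℤ.* z ℤ.- a ℤ.* a)) (trans (sum-cong-≗ av) (sum-replicate-zero n))) (lem (+ n) a)))
    where
    lem : ∀ N a → N ℤ.* (N ℤ.* 0ℤ ℤ.- a ℤ.* a) ≡ ℤ.- (N ℤ.* (a ℤ.* a))
    lem = solve-∀

-- The family and why it covers

-- Passes the potential bound through a growth by at most `B/A`, cancelling one factor `A`.
potential-step : ∀ A {B X Z p q : ℕ} {Φ Φ′ : ℤ} .{{_ : ℕ.NonZero A}} → + A ℤ.* Φ′ ℤ.≤ + B ℤ.* Φ →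
  Φ ℤ.* + (X ℕ.* (B ℕ.* p)) ℤ.≤ + (Z ℕ.* (A ℕ.* q)) → Φ′ ℤ.* + (X ℕ.* p) ℤ.≤ + (Z ℕ.* q)
potential-step A@(suc _) {B} {X} {Z} {p} {q} {Φ} {Φ′} h₁ h₂ =
  ℤₚ.*-cancelˡ-≤-pos (Φ′ ℤ.* + (X ℕ.* p)) (+ (Z ℕ.* q)) (+ A)
    (≤-from-diff (trans (cong₂ (λ s t → + A ℤ.* (Φ′ ℤ.* + (X ℕ.* p)) ℤ.+ ((s ℤ.- Φ ℤ.* t) ℤ.+ + (X ℕ.* p) ℤ.* (+ B ℤ.* Φ ℤ.- + A ℤ.* Φ′)))
        (pos-*-swap Z A q) (pos-*-swap X B p)) (lem (+ A) (+ B) Φ Φ′ (+ (X ℕ.* p)) (+ (Z ℕ.* q))))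
      (ℤₚ.+-mono-≤ (ℤₚ.i≤j⇒0≤j-i h₂) (0≤* {+ (X ℕ.* p)} (ℤ.+≤+ z≤n) (ℤₚ.i≤j⇒0≤j-i h₁))))
  where
  pos-*-swap : ∀ x y z → + (x ℕ.* (y ℕ.* z)) ≡ + y ℤ.* + (x ℕ.* z)
  pos-*-swap x y z = trans (cong +_ (trans (sym (ℕₚ.*-assoc x y z)) (trans (cong (ℕ._* z) (ℕₚ.*-comm x y)) (ℕₚ.*-assoc y x z)))) (ℤₚ.pos-* y (x ℕ.* z))
  lem : ∀ A B Φ Φ′ s t → A ℤ.* (Φ′ ℤ.* s) ℤ.+ ((A ℤ.* t ℤ.- Φ ℤ.* (B ℤ.* s)) ℤ.+ s ℤ.* (B ℤ.* Φ ℤ.- A ℤ.* Φ′)) ≡ A ℤ.* t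
  lem = solve-∀

module Family {n : ℕ} (G : FinAbGroup n) (κ j : ℕ) (j<κm : suc j ℕ.≤ κ ℕ.* (2 ℕ.+ j)) where
  open GroupRing G
  open Moments G
  open Potential G κ j j<κm

  -- The tree branches over every `t`, so it is fixed before any set `A` is given; `A` only selects
  -- a branch.
  family : Fin n → ℕ → ℤ[G] → List (Subset n)
  family c zero    Y = List.[]
  family c (suc r) Y = F c Y List.∷ concat (List.tabulate λ t → family c r (Y - U t))

  family-large : ∀ c r {Y} → Valid r Y → All (λ S → n ℕ.≤ ∣ S ∣ ℕ.* (κ ℕ.* κ ℕ.+ 2)) (family c r Y)
  family-large c zero    v = All.[]
  family-large c (suc r) v = F-large c v All.∷ All.concat⁺ (All.tabulate⁺ λ t → family-large c r (Valid-step t v))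

  -- The head is counted by `1 ≤ (n + 1)^r` and the `n` subtrees by `n (n + 1)^r`.
  family-length : ∀ c r Y → length (family c r Y) ℕ.≤ suc n ℕ.^ r
  family-length c zero    Y = z≤n
  family-length c (suc r) Y = ℕₚ.+-mono-≤ (ℕₚ.m^n>0 (suc n) r) (length-concat-tabulate _ (λ t → family-length c r (Y - U t)))

  K : ℕ
  K = κ ℕ.* m

  start : ℤ[G]
  start = ι (4 ℕ.* K)

  start-Valid : Valid K start
  start-Valid = valid 𝟘 zero (begin
    (k ⊕ k) ⊕ (ι K ⊕ ι K ⊕ 𝟘)
      ≈⟨ +-congʳ (⊕-cong (×1-homo-* κ m) (×1-homo-* κ m)) ⟨
    (ι K ⊕ ι K) ⊕ (ι K ⊕ ι K ⊕ 𝟘)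
      ≈⟨ ≈-trans (+-assoc _ _ _) (+-congˡ (+-congˡ (+-assoc _ _ _))) ⟩
    ι K ⊕ (ι K ⊕ (ι K ⊕ (ι K ⊕ 𝟘)))
      ≈⟨ ≈-trans (×-homo-+ [ ε ] K _) (+-congˡ (≈-trans (×-homo-+ [ ε ] K _) (+-congˡ (≈-trans (×-homo-+ [ ε ] K _) (+-congˡ (×-homo-+ [ ε ] K 0)))))) ⟨
    ι (4 ℕ.* K) ∎)
    where open import Relation.Binary.Reasoning.Setoid setoid

  Φ-start : Φ start ≡ + ((4 ℕ.* K) ℕ.^ m)
  Φ-start = trans (sym (*-identityʳ (start ^ m) .at ε))
    (trans (ι^-⋆ (4 ℕ.* K) m [ ε ] ε) (trans (cong (ℤ._*_ (+ ((4 ℕ.* K) ℕ.^ m))) 1-ε) (ℤₚ.*-identityʳ _)))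

  module Cover {f : Fin n → ℤ} (f-idem : ∀ x → f x ℤ.* f x ≡ f x)
    {α : ℕ} (a≡α : sum f ≡ + α)
    (d e : ℕ) (K≡de : d ℕ.* e ≡ K) (1≤n : 1 ℕ.≤ n) (1≤κ : 1 ℕ.≤ κ) (dense : n ℕ.≤ d ℕ.* α)
    (absurd : (4 ℕ.* K ℕ.+ 2 ℕ.* e) ℕ.^ m ℕ.* (κ ℕ.* κ) ℕ.^ K ℕ.≤ n ℕ.* ((κ ℕ.* κ ℕ.+ 2) ℕ.^ K ℕ.* (4 ℕ.* K) ℕ.^ m) → ⊥)
    (c : Fin n) where
    open Bias G f f-idem

    A B Z : ℕ
    A = κ ℕ.* κ
    B = κ ℕ.* κ ℕ.+ 2
    Z = B ℕ.^ K ℕ.* (4 ℕ.* K) ℕ.^ m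

    b w₀ : ℤ
    b = + n ℤ.* (a ℤ.* a)
    w₀ = w ⟨ ε ⟩

    ψ : ℤ[G] → ℤ
    ψ Y = (w ⋆ Y) ⟨ ε ⟩

    κ²≡ : κ² ≡ + A
    κ²≡ = sym (ℤₚ.pos-* κ κ)

    SOS-w : SOS w
    SOS-w = square h

    -- After `K - r` steps this says `Φ Y ≤ (4K)^m (B/A)^(K-r)` and `ψ Y ≥ 4K w₀ + 2(K - r) b`,
    -- arranged without division or subtraction.
    record Invariant (r : ℕ) (Y : ℤ[G]) : Set where
      field
        validity    : Valid r Y
        potential   : Φ Y ℤ.* + (A ℕ.^ K ℕ.* B ℕ.^ r) ℤ.≤ + (Z ℕ.* A ℕ.^ r)
        correlation : + (4 ℕ.* K) ℤ.* w₀ ℤ.+ + (2 ℕ.* K) ℤ.* b ℤ.≤ ψ Y ℤ.+ + (2 ℕ.* r) ℤ.* b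
    open Invariant

    Invariant-start : Invariant K start
    Invariant-start .validity = start-Valid
    Invariant-start .potential = ℤₚ.≤-reflexive (trans (cong (ℤ._* + (A ℕ.^ K ℕ.* B ℕ.^ K)) Φ-start)
      (trans (sym (ℤₚ.pos-* ((4 ℕ.* K) ℕ.^ m) (A ℕ.^ K ℕ.* B ℕ.^ K))) (cong +_ (lem ((4 ℕ.* K) ℕ.^ m) (A ℕ.^ K) (B ℕ.^ K)))))
      where
      lem : ∀ x y z → x ℕ.* (y ℕ.* z) ≡ z ℕ.* x ℕ.* y
      lem = ℕ-solve-∀
    Invariant-start .correlation = ℤₚ.≤-reflexive (cong (ℤ._+ + (2 ℕ.* K) ℤ.* b)
      (sym (trans (⋆-comm w start .at ε) (ι-⋆ (4 ℕ.* K) w ε))))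

    -- By symmetry `w` equals `-b` at both `t` and its inverse, so removing `U_t` gains `2b`.
    ψ-step : ∀ {t} Y → Avoids t → ψ (Y - U t) ≡ ψ Y ℤ.+ + 2 ℤ.* b
    ψ-step {t} Y av = solve-for (ψ (Y - U t)) (ψ Y) b (trans
      (cong (ℤ._+_ (ψ (Y - U t))) (sym (trans (⋆-U w t) (cong₂ ℤ._+_ (w-avoids av) (trans (SOS-symmetric SOS-w .at t) (w-avoids av))))))
      (trans (sym (distribˡ w (Y - U t) (U t) .at ε)) (*-congˡ {w} (sub-add Y (U t)) .at ε)))
      where
      solve-for : ∀ x y b → x ℤ.+ (ℤ.- b ℤ.+ ℤ.- b) ≡ y → x ≡ y ℤ.+ + 2 ℤ.* b
      solve-for x .(x ℤ.+ (ℤ.- b ℤ.+ ℤ.- b)) b refl = lem x b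
        where
        lem : ∀ x b → x ≡ x ℤ.+ (ℤ.- b ℤ.+ ℤ.- b) ℤ.+ + 2 ℤ.* b
        lem = solve-∀

    Invariant-step : ∀ {r Y t} → Flat Y t → Avoids t → Invariant (suc r) Y → Invariant r (Y - U t)
    Invariant-step {t = t} flat av inv .validity = Valid-step t (inv .validity)
    Invariant-step {r} {Y} {t} flat av inv .potential = potential-step A {B} {A ℕ.^ K} {Z} {B ℕ.^ r} {A ℕ.^ r} {Φ Y} {Φ (Y - U t)}
      {{ℕₚ.m*n≢0 κ κ {{ℕ.>-nonZero 1≤κ}} {{ℕ.>-nonZero 1≤κ}}}}
      (subst (λ z → z ℤ.* Φ (Y - U t) ℤ.≤ (z ℤ.+ + 2) ℤ.* Φ Y) κ²≡ flat) (inv .potential)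
    Invariant-step {r} {Y} {t} flat av inv .correlation = ℤₚ.≤-trans (inv .correlation) (ℤₚ.≤-reflexive
      (trans (cong (λ z → ψ Y ℤ.+ z ℤ.* b) (trans (cong +_ (ℕₚ.*-distribˡ-+ 2 1 r)) (ℤₚ.pos-+ 2 (2 ℕ.* r))))
        (trans (lem (ψ Y) b (+ (2 ℕ.* r))) (cong (ℤ._+ + (2 ℕ.* r) ℤ.* b) (sym (ψ-step Y av))))))
      where
      lem : ∀ y b r → y ℤ.+ (+ 2 ℤ.+ r) ℤ.* b ≡ y ℤ.+ + 2 ℤ.* b ℤ.+ r ℤ.* b
      lem = solve-∀

    -- After `K` steps the correlation forces `(4K + 2e)^m ≤ n Φ Y`, while the potential is at most
    -- `(4K)^m (B/A)^K`; `absurd` excludes this.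
    Invariant-end : ∀ {Y} → ¬ Invariant 0 Y
    Invariant-end {Y} inv = absurd (ℤ.drop‿+≤+ (subst₂ ℤ._≤_ (sym (ℤₚ.pos-* (c₀ ℕ.^ m) (A ℕ.^ K))) (sym (ℤₚ.pos-* n Z))
      (chain (+ n) (Φ Y) moments (subst₂ ℤ._≤_
        (cong (λ z → Φ Y ℤ.* + z) (ℕₚ.*-identityʳ (A ℕ.^ K))) (cong +_ (ℕₚ.*-identityʳ Z)) (inv .potential)))))
      where
      c₀ : ℕ
      c₀ = 4 ℕ.* K ℕ.+ 2 ℕ.* e
      corr : + (4 ℕ.* K) ℤ.* w₀ ℤ.+ + (2 ℕ.* K) ℤ.* b ℤ.≤ ψ Y
      corr = subst (_ ℤ.≤_) (lem (ψ Y) b) (inv .correlation)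
        where
        lem : ∀ y b → y ℤ.+ + 0 ℤ.* b ≡ y
        lem = solve-∀
      w₀≡ : w₀ ≡ + n ℤ.* (+ n ℤ.* + α ℤ.- + α ℤ.* + α)
      w₀≡ = trans w-ε (cong (λ a → + n ℤ.* (+ n ℤ.* a ℤ.- a ℤ.* a)) a≡α)
      b≡ : b ≡ + n ℤ.* (+ α ℤ.* + α)
      b≡ = cong (λ a → + n ℤ.* (a ℤ.* a)) a≡α
      1≤α : 1 ℕ.≤ α
      1≤α = positive α (ℕₚ.≤-trans 1≤n dense)
        where
        positive : ∀ x → 1 ℕ.≤ d ℕ.* x → 1 ℕ.≤ x
        positive zero    h = subst (1 ℕ.≤_) (ℕₚ.*-zeroʳ d) h
        positive (suc x) h = s≤s z≤n
      1≤2Kb : 1ℤ ℤ.≤ + (2 ℕ.* K) ℤ.* b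
      1≤2Kb = subst (1ℤ ℤ.≤_)
        (trans (ℤₚ.pos-* (2 ℕ.* K) (n ℕ.* (α ℕ.* α))) (cong (ℤ._*_ (+ (2 ℕ.* K)))
          (trans (ℤₚ.pos-* n (α ℕ.* α)) (trans (cong (ℤ._*_ (+ n)) (ℤₚ.pos-* α α)) (sym b≡)))))
        (ℤ.+≤+ (ℕₚ.*-mono-≤ {1} {2 ℕ.* K} (ℕₚ.*-mono-≤ {1} {2} (s≤s z≤n) (ℕₚ.*-mono-≤ 1≤κ (s≤s {n = suc j} z≤n)))
                            (ℕₚ.*-mono-≤ 1≤n (ℕₚ.*-mono-≤ 1≤α 1≤α))))
      -- If `w₀` vanished, the pairing bound would give `ψ Y ≤ 0`, against `ψ Y ≥ 2K b ≥ 1`.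
      1≤w₀ : 1ℤ ℤ.≤ w₀
      1≤w₀ = positive w₀ {+ (4 ℕ.* K)} (SOS-nonneg SOS-w) corr (SOS-pairing-bound SOS-w (Valid⇒SOS (inv .validity)))
        where
        positive : ∀ w {x y q} → 0ℤ ℤ.≤ w → x ℤ.* w ℤ.+ + (2 ℕ.* K) ℤ.* b ℤ.≤ y → y ℤ.≤ + n ℤ.* (w ℤ.* q) → 1ℤ ℤ.≤ w
        positive (+ suc _) _ _ _ = ℤ.+≤+ (s≤s z≤n)
        positive (+ 0) {x} {y} {q} _ h₁ h₂ = contradiction
          (ℤₚ.≤-trans 1≤2Kb (subst₂ ℤ._≤_ (lem₁ x (+ (2 ℕ.* K) ℤ.* b)) (lem₂ (+ n) q) (ℤₚ.≤-trans h₁ h₂))) λ { (ℤ.+≤+ ()) }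
          where
          lem₁ : ∀ x y → x ℤ.* + 0 ℤ.+ y ≡ y
          lem₁ = solve-∀
          lem₂ : ∀ x y → x ℤ.* (+ 0 ℤ.* y) ≡ 0ℤ
          lem₂ = solve-∀
      -- Here density enters. With `K = d e` it turns the gain `2K b` into at least `2e w₀`, whence
      -- `c₀ = 4K + 2e`.
      w₀≤db : w₀ ℤ.≤ + d ℤ.* b
      w₀≤db = subst₂ (λ x y → x ℤ.≤ + d ℤ.* y) (sym w₀≡) (sym b≡) (≤-from-diff (lem (+ n) (+ α) (+ d))
        (ℤₚ.+-mono-≤ (0≤* {+ n} (ℤ.+≤+ z≤n) (0≤* {+ α} (ℤ.+≤+ z≤n) (ℤₚ.i≤j⇒0≤j-i (subst (+ n ℤ.≤_) (ℤₚ.pos-* d α) (ℤ.+≤+ dense)))))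
          (0≤* {+ n} (ℤ.+≤+ z≤n) (0≤x*x (+ α)))))
        where
        lem : ∀ n α d → n ℤ.* (n ℤ.* α ℤ.- α ℤ.* α) ℤ.+ (n ℤ.* (α ℤ.* (d ℤ.* α ℤ.- n)) ℤ.+ n ℤ.* (α ℤ.* α)) ≡ d ℤ.* (n ℤ.* (α ℤ.* α))
        lem = solve-∀
      c₀w₀≤ψ : + c₀ ℤ.* w₀ ℤ.≤ ψ Y
      c₀w₀≤ψ = ℤₚ.≤-trans (≤-from-diff
        (trans (cong₂ (λ x y → x ℤ.* w₀ ℤ.+ y) (trans (ℤₚ.pos-+ (4 ℕ.* K) (2 ℕ.* e)) (cong (ℤ._+_ (+ (4 ℕ.* K))) (ℤₚ.pos-* 2 e))) refl)
          (trans (lem (+ (4 ℕ.* K)) (+ d) (+ e) w₀ b) (cong (λ x → + (4 ℕ.* K) ℤ.* w₀ ℤ.+ x ℤ.* b) (sym 2K≡))))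
        (0≤* {+ 2} (ℤ.+≤+ z≤n) (0≤* {+ e} (ℤ.+≤+ z≤n) (ℤₚ.i≤j⇒0≤j-i w₀≤db)))) corr
        where
        2K≡ : + (2 ℕ.* K) ≡ + 2 ℤ.* (+ d ℤ.* + e)
        2K≡ = trans (ℤₚ.pos-* 2 K) (cong (ℤ._*_ (+ 2)) (trans (cong +_ (sym K≡de)) (ℤₚ.pos-* d e)))
        lem : ∀ x d e w b → (x ℤ.+ + 2 ℤ.* e) ℤ.* w ℤ.+ + 2 ℤ.* (e ℤ.* (d ℤ.* b ℤ.- w)) ≡ x ℤ.* w ℤ.+ + 2 ℤ.* (d ℤ.* e) ℤ.* b
        lem = solve-∀
      moments : + (c₀ ℕ.^ m) ℤ.≤ + n ℤ.* Φ Y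
      moments = moment-bound {c = c₀} SOS-w (Valid⇒SOS (inv .validity)) 1≤w₀ c₀w₀≤ψ (suc j)
      chain : ∀ N Φ → + (c₀ ℕ.^ m) ℤ.≤ N ℤ.* Φ → Φ ℤ.* + (A ℕ.^ K) ℤ.≤ + Z → {{ℤ.NonNegative N}} →
        + (c₀ ℕ.^ m) ℤ.* + (A ℕ.^ K) ℤ.≤ N ℤ.* + Z
      chain N Φ h₁ h₂ = ℤₚ.≤-trans (ℤₚ.*-monoʳ-≤-nonNeg (+ (A ℕ.^ K)) h₁)
        (subst (ℤ._≤ N ℤ.* + Z) (sym (ℤₚ.*-assoc N Φ (+ (A ℕ.^ K)))) (ℤₚ.*-monoˡ-≤-nonNeg N h₂))

    -- Either the current `F` meets no translate by `c` of an avoided `t`, and it is the required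
    -- set, or such a point is flat and avoided, so the invariant passes to that child.
    -- `Invariant-end` rules out reaching depth zero.
    cover : ∀ r Y → Invariant r Y → Any (λ S → ∀ x → x ∈ S → ¬ Avoids (c ⁻¹ ∙ x)) (family c r Y)
    cover zero Y inv = contradiction inv Invariant-end
    cover (suc r) Y inv with any? (λ x → (x ∈? F c Y) ×-dec avoids? (c ⁻¹ ∙ x))
    ... | no ¬p = Any.here (λ x x∈F av → ¬p (x , x∈F , av))
    ... | yes (x , x∈F , av) = Any.there (Any.concat⁺ (Any.tabulate⁺ (c ⁻¹ ∙ x)
            (cover r (Y - U (c ⁻¹ ∙ x)) (Invariant-step (∈F⇒Flat {c} {Y} x∈F) av inv))))

-- Densities and sumsets

-- A positive numerator is at least one, so the density is at least the reciprocal of the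
-- denominator. Unnormalised rationals reduce the comparison to integers.
fraction⇒card : ∀ {n} (δ : ℚ) → Positive δ → (A : Subset n) → AtLeastFraction δ A → n ℕ.≤ ∣ A ∣ ℕ.* ℚ.↧ₙ δ
fraction⇒card {n} δ@(ℚ.mkℚ (+ suc p) q _) _ A h with ℚᵘₚ.≤-respʳ-≃ (ℚₚ.toℚᵘ-fromℚᵘ (ℚᵘ.mkℚᵘ (+ ∣ A ∣) 0))
  (ℚᵘₚ.≤-respˡ-≃ (ℚᵘₚ.≃-trans (ℚₚ.toℚᵘ-homo-* δ (ℕ→ℚ n)) (ℚᵘₚ.*-congˡ (ℚₚ.toℚᵘ-fromℚᵘ (ℚᵘ.mkℚᵘ (+ n) 0)))) (ℚₚ.toℚᵘ-mono-≤ h))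
... | ℚᵘ.*≤* i = ℕₚ.≤-trans (ℕₚ.m≤m+n n (p ℕ.* n)) (ℤ.drop‿+≤+ (subst₂ ℤ._≤_
  (trans (ℤₚ.*-identityʳ (+ suc p ℤ.* + n)) (sym (ℤₚ.pos-* (suc p) n)))
  (trans (sym (ℤₚ.pos-* ∣ A ∣ (suc q ℕ.* 1))) (cong (λ z → + (∣ A ∣ ℕ.* z)) (ℕₚ.*-identityʳ (suc q)))) i))

card⇒fraction : ∀ {n} D (A : Subset n) → n ℕ.≤ ∣ A ∣ ℕ.* suc D → AtLeastFraction (+ 1 ℚ./ suc D) A
card⇒fraction {n} D A h = ℚₚ.toℚᵘ-cancel-≤ (ℚᵘₚ.≤-respʳ-≃ (ℚᵘₚ.≃-sym (ℚₚ.toℚᵘ-fromℚᵘ (ℚᵘ.mkℚᵘ (+ ∣ A ∣) 0)))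
  (ℚᵘₚ.≤-respˡ-≃ (ℚᵘₚ.≃-sym (ℚᵘₚ.≃-trans (ℚₚ.toℚᵘ-homo-* (+ 1 ℚ./ suc D) (ℕ→ℚ n))
      (ℚᵘₚ.*-cong (ℚₚ.toℚᵘ-fromℚᵘ (ℚᵘ.mkℚᵘ (+ 1) D)) (ℚₚ.toℚᵘ-fromℚᵘ (ℚᵘ.mkℚᵘ (+ n) 0)))))
    (ℚᵘ.*≤* (subst₂ ℤ._≤_
      (sym (trans (ℤₚ.*-identityʳ (+ 1 ℤ.* + n)) (ℤₚ.*-identityˡ (+ n))))
      (trans (ℤₚ.pos-* ∣ A ∣ (suc D)) (cong (λ z → + ∣ A ∣ ℤ.* + z) (sym (ℕₚ.*-identityʳ (suc D))))) (ℤ.+≤+ h)))))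

-- Otherwise every `n g(c) + 1` is at most the sum of `g`; adding these over all `c` contradicts
-- `1 ≤ n`.
some-above-average : ∀ {n} → 1 ℕ.≤ n → (g : Fin n → ℤ) → ∃ λ c → sum g ℤ.≤ + n ℤ.* g c
some-above-average {n} 1≤n g with any? (λ c → sum g ℤ.≤? + n ℤ.* g c)
... | yes p = p
... | no ¬p = contradiction (ℤₚ.≤-trans (ℤ.+≤+ 1≤n)
      (≤-from-diff (lem (+ n) (sum g)) (ℤₚ.i≤j⇒0≤j-i below))) λ { (ℤ.+≤+ ()) }
  where
  below : + n ℤ.* sum g ℤ.+ + n ℤ.≤ + n ℤ.* sum g
  below = subst₂ ℤ._≤_
    (trans (∑-distrib-+ (λ c → + n ℤ.* g c) (λ _ → 1ℤ)) (cong₂ ℤ._+_ (sym (*-distribˡ-sum (+ n) g)) (trans (sum-const n 1ℤ) (ℤₚ.*-identityʳ (+ n)))))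
    (sum-const n (sum g))
    (sum-mono _ _ (λ c → subst (ℤ._≤ sum g) (ℤₚ.+-comm 1ℤ (+ n ℤ.* g c)) (ℤₚ.i<j⇒suc[i]≤j (ℤₚ.≰⇒> (λ h → ¬p (c , h))))))
  lem : ∀ n s → n ℤ.+ (n ℤ.* s ℤ.- (n ℤ.* s ℤ.+ n)) ≡ 0ℤ
  lem = solve-∀

indicator-idem : ∀ b → indicator b ℤ.* indicator b ≡ indicator b
indicator-idem true  = refl
indicator-idem false = refl

indicator-true : ∀ b → ¬ (indicator b ≡ 0ℤ) → b ≡ true
indicator-true true  _ = refl
indicator-true false h = contradiction refl h

-- From quotients back to sumsets

module Sumset {n : ℕ} (G : FinAbGroup n) (A : Subset n) where
  open GroupRing G

  χ : ℤ[G]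
  χ ⟨ x ⟩ = indicator (lookup A x)

  -- The indicator of A ∩ cA⁻¹.
  common : Fin n → Fin n → ℤ
  common c y = χ ⟨ y ⟩ ℤ.* χ ⟨ y ⁻¹ ∙ c ⟩

  common-idem : ∀ c y → common c y ℤ.* common c y ≡ common c y
  common-idem c y = trans (lem (χ ⟨ y ⟩) (χ ⟨ y ⁻¹ ∙ c ⟩))
    (cong₂ ℤ._*_ (indicator-idem (lookup A y)) (indicator-idem (lookup A (y ⁻¹ ∙ c))))
    where
    lem : ∀ a b → (a ℤ.* b) ℤ.* (a ℤ.* b) ≡ (a ℤ.* a) ℤ.* (b ℤ.* b)
    lem = solve-∀

  -- The sum of `common c` is the coefficient of `χ ⋆ χ` at `c`, so the total is an augmentation.
  ∑common : sum (λ c → sum (common c)) ≡ + (∣ A ∣ ℕ.* ∣ A ∣)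
  ∑common = trans (sum-⋆ χ χ) (trans (cong (λ z → z ℤ.* z) (sym (card-sum A))) (sym (ℤₚ.pos-* ∣ A ∣ ∣ A ∣)))

  nonzero-factors : ∀ {a b} → ¬ (a ℤ.* b ≡ 0ℤ) → ¬ (a ≡ 0ℤ) × ¬ (b ≡ 0ℤ)
  nonzero-factors {a} {b} h = (λ e → h (trans (cong (ℤ._* b) e) (ℤₚ.*-zeroˡ b))) , (λ e → h (trans (cong (ℤ._*_ a) e) (ℤₚ.*-zeroʳ a)))

  module _ (c : Fin n) where
    open Bias G (common c) (common-idem c)

    -- Write `c⁻¹ x = y z⁻¹` with `y` and `z` in `A ∩ c A⁻¹`. Then `z⁻¹ c` lies in `A` and
    -- `x = y (z⁻¹ c)`.
    ¬Avoids⇒∈sumset : ∀ x → ¬ Avoids (c ⁻¹ ∙ x) → ∃ λ a → ∃ λ b → a ∈ A × b ∈ A × a ∙ b ≡ x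
    ¬Avoids⇒∈sumset x ¬av with ¬∀⟶∃¬ n _ (λ y → common c y ℤ.* common c ((c ⁻¹ ∙ x) ⁻¹ ∙ y) ℤ.≟ 0ℤ) ¬av
    ... | y , h with nonzero-factors {common c y} h
    ... | h₁ , h₂ with nonzero-factors {χ ⟨ y ⟩} h₁ | nonzero-factors {χ ⟨ (c ⁻¹ ∙ x) ⁻¹ ∙ y ⟩} h₂
    ... | hy , _ | _ , hb = y , ((c ⁻¹ ∙ x) ⁻¹ ∙ y) ⁻¹ ∙ c ,
      lookup⇒[]= y A (indicator-true _ hy) , lookup⇒[]= _ A (indicator-true _ hb) , (begin
        y ∙ (((c ⁻¹ ∙ x) ⁻¹ ∙ y) ⁻¹ ∙ c)
          ≡⟨ cong (λ z → y ∙ (z ∙ c)) (trans (⁻¹-anti-homo-∙ ((c ⁻¹ ∙ x) ⁻¹) y) (cong (y ⁻¹ ∙_) (⁻¹-involutive (c ⁻¹ ∙ x)))) ⟩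
        y ∙ (y ⁻¹ ∙ (c ⁻¹ ∙ x) ∙ c)
          ≡⟨ cong (y ∙_) (assoc (y ⁻¹) (c ⁻¹ ∙ x) c) ⟩
        y ∙ (y ⁻¹ ∙ (c ⁻¹ ∙ x ∙ c))
          ≡⟨ \\-leftDividesˡ y (c ⁻¹ ∙ x ∙ c) ⟩
        c ⁻¹ ∙ x ∙ c
          ≡⟨ comm (c ⁻¹ ∙ x) c ⟩
        c ∙ (c ⁻¹ ∙ x)
          ≡⟨ \\-leftDividesˡ c x ⟩
        x ∎)
      where open ≡-Reasoning

-- Choice of parameters and assembly of the family

module Construction (D : ℕ) .{{_ : ℕ.NonZero D}} {n : ℕ} (2≤n : 2 ℕ.≤ n) (G : FinAbGroup n) where
  d L : ℕ
  d = D ℕ.* D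
  L = ⌈log₂ n ⌉

  instance
    d≢0 : ℕ.NonZero d
    d≢0 = ℕₚ.m*n≢0 D D
    κ≢0 : ℕ.NonZero (16 ℕ.* d)
    κ≢0 = ℕₚ.m*n≢0 16 d
    n≢0 : ℕ.NonZero n
    n≢0 = ℕ.>-nonZero (ℕₚ.≤-trans (s≤s z≤n) 2≤n)

  κ j : ℕ
  κ = 16 ℕ.* d
  j = Arithmetic.m d L ℕ.∸ 2

  m≡ : 2 ℕ.+ j ≡ Arithmetic.m d L
  m≡ = ℕₚ.m+[n∸m]≡n (ℕₚ.≤-trans (s≤s (ℕₚ.≤-trans (s≤s z≤n) (ℕₚ.m≤m*n 4 d))) (ℕₚ.m≤m*n (Arithmetic.e d L) (suc L)))

  open Family G κ j (ℕₚ.≤-trans (ℕₚ.n≤1+n (suc j)) (ℕₚ.m≤n*m (2 ℕ.+ j) κ))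

  𝓕 : List (Subset n)
  𝓕 = concat (List.tabulate λ c → family c K start)

  𝓕-large : All (λ S → n ℕ.≤ ∣ S ∣ ℕ.* (κ ℕ.* κ ℕ.+ 2)) 𝓕
  𝓕-large = All.concat⁺ (All.tabulate⁺ λ c → family-large c K start-Valid)

  𝓕-length : length 𝓕 ℕ.≤ sizeBound (suc (64 ℕ.* d ℕ.* suc (4 ℕ.* d))) n
  𝓕-length = ℕₚ.≤-trans (length-concat-tabulate _ (λ c → family-length c K start))
    (subst (λ x → n ℕ.* suc n ℕ.^ (κ ℕ.* x) ℕ.≤ sizeBound (suc (64 ℕ.* d ℕ.* suc (4 ℕ.* d))) n) (sym m≡)
      (Arithmetic.family-bound d L n (Arithmetic.n≤2^⌈log₂n⌉ n) (Arithmetic.1≤⌈log₂n⌉ 2≤n)))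

  no-growth : (4 ℕ.* K ℕ.+ 2 ℕ.* (16 ℕ.* (2 ℕ.+ j))) ℕ.^ (2 ℕ.+ j) ℕ.* (κ ℕ.* κ) ℕ.^ K
    ℕ.≤ n ℕ.* ((κ ℕ.* κ ℕ.+ 2) ℕ.^ K ℕ.* (4 ℕ.* K) ℕ.^ (2 ℕ.+ j)) → ⊥
  no-growth = subst (λ x → (4 ℕ.* (κ ℕ.* x) ℕ.+ 2 ℕ.* (16 ℕ.* x)) ℕ.^ x ℕ.* (κ ℕ.* κ) ℕ.^ (κ ℕ.* x)
    ℕ.≤ n ℕ.* ((κ ℕ.* κ ℕ.+ 2) ℕ.^ (κ ℕ.* x) ℕ.* (4 ℕ.* (κ ℕ.* x)) ℕ.^ x) → ⊥) (sym m≡)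
    (Arithmetic.growth-contradiction d L n (Arithmetic.n≤2^⌈log₂n⌉ n))

  1≤n : 1 ℕ.≤ n
  1≤n = ℕₚ.≤-trans (s≤s z≤n) 2≤n

  𝓕-covers : (A : Subset n) → n ℕ.≤ ∣ A ∣ ℕ.* D → Any (λ S → S ⊆ A +ˢ A within G) 𝓕
  𝓕-covers A dense with some-above-average 1≤n (λ c → sum (Sumset.common G A c))
  ... | c , h = Any.concat⁺ (Any.tabulate⁺ c (Any.map (λ ¬av x x∈S → ¬Avoids⇒∈sumset c x (¬av x x∈S))
          (cover K start Invariant-start)))
    where
    open Sumset G A
    α : ℕ
    α = ℤ.∣ sum (common c) ∣
    a≡α : sum (common c) ≡ + α
    a≡α = sym (ℤₚ.0≤i⇒+∣i∣≡i (sum-nonneg (common c) (λ y → subst (0ℤ ℤ.≤_) (common-idem c y) (0≤x*x (common c y)))))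
    K≡de : ∀ d x → d ℕ.* (16 ℕ.* x) ≡ 16 ℕ.* d ℕ.* x
    K≡de = ℕ-solve-∀
    A²≤nα : ∣ A ∣ ℕ.* ∣ A ∣ ℕ.≤ n ℕ.* α
    A²≤nα = ℤ.drop‿+≤+ (subst₂ ℤ._≤_ ∑common (trans (cong (ℤ._*_ (+ n)) a≡α) (sym (ℤₚ.pos-* n α))) h)
    n≤dα : n ℕ.≤ d ℕ.* α
    -- Averaging squares the density: `n² ≤ D² |A|² ≤ D² n α`, hence `d = D²`.
    n≤dα = ℕₚ.*-cancelˡ-≤ n (begin
      n ℕ.* n                              ≤⟨ ℕₚ.*-mono-≤ dense dense ⟩
      (∣ A ∣ ℕ.* D) ℕ.* (∣ A ∣ ℕ.* D)      ≡⟨ lem₁ ∣ A ∣ D ⟩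
      (∣ A ∣ ℕ.* ∣ A ∣) ℕ.* (D ℕ.* D)      ≤⟨ ℕₚ.*-monoˡ-≤ (D ℕ.* D) A²≤nα ⟩
      n ℕ.* α ℕ.* (D ℕ.* D)                ≡⟨ lem₂ n α D ⟩
      n ℕ.* (D ℕ.* D ℕ.* α)                ∎)
      where
      open ℕₚ.≤-Reasoning
      lem₁ : ∀ a D → (a ℕ.* D) ℕ.* (a ℕ.* D) ≡ (a ℕ.* a) ℕ.* (D ℕ.* D)
      lem₁ = ℕ-solve-∀
      lem₂ : ∀ n α D → n ℕ.* α ℕ.* (D ℕ.* D) ≡ n ℕ.* (D ℕ.* D ℕ.* α)
      lem₂ = ℕ-solve-∀
    -- As `K = 16dm`, the choice `e = 16m` satisfies `K = d e`, and the relative gain `2e/4K` is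
    -- `1/2d`.
    open Cover (common-idem c) a≡α d (16 ℕ.* (2 ℕ.+ j)) (K≡de d (2 ℕ.+ j)) 1≤n (ℕ.>-nonZero⁻¹ κ) n≤dα no-growth c

theorem1p7 : (δ : ℚ) → Positive δ →
    Σ ℚ λ ε → Positive ε × Σ ℕ λ C →
    (n : ℕ) → 2 ≤ n → (G : FinAbGroup n) →
    Σ (List (Subset n)) λ 𝓕 →
    All (AtLeastFraction ε) 𝓕 ×
    length 𝓕 ≤ sizeBound C n ×
    ((A : Subset n) → AtLeastFraction δ A →
    Any (λ F → F ⊆ A +ˢ A within G) 𝓕)
-- The density `1/(κ² + 2)` comes from `F-large` and `C` from `family-bound`; both depend only on
-- the denominator of `δ`. The double successor makes the new denominator visibly nonzero.
theorem1p7 δ δ>0 = + 1 ℚ./ suc (suc (κ ℕ.* κ)) , ℚₚ.normalize-pos 1 (suc (suc (κ ℕ.* κ))) , suc (64 ℕ.* d ℕ.* suc (4 ℕ.* d)) ,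
  λ n 2≤n G → let open Construction (ℚ.↧ₙ δ) 2≤n G using (𝓕; 𝓕-large; 𝓕-length; 𝓕-covers) in
    𝓕 ,
    All.map (λ {S} h → card⇒fraction (suc (κ ℕ.* κ)) S (subst (λ z → n ℕ.≤ ∣ S ∣ ℕ.* z) (ℕₚ.+-comm (κ ℕ.* κ) 2) h)) 𝓕-large ,
    𝓕-length ,
    λ A h → 𝓕-covers A (fraction⇒card δ δ>0 A h)
  where
  d κ : ℕ
  d = ℚ.↧ₙ δ ℕ.* ℚ.↧ₙ δ
  κ = 16 ℕ.* d
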